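{- Let $f=a_0+a_1z+\cdots+a_nz^n\in\mathbb{Z}[z]$ be a primitive polynomial with $a_0a_n\neq 0$. Suppose there exists a positive integer $m\geq h_f+2$ for which $f(m)=\pm p_1^{k_1}\cdots p_r^{k_r}$, where $k_1,\ldots,k_r$ are positive integers and $p_1,\ldots,p_r$ are primes which are pairwise distinct when $r\geq 2$. Suppose that for each $i=1,\ldots,r$ there is a positive integer $j_i\leq n$ such that: (i) $v_{p_i}(s_{j_i}(m))=0$ and $\gcd(k_i,j_i)=1$; (ii) if $j_i>1$, then $\frac{k_i}{j_i}<\frac{v_{p_i}(s_t(m))}{j_i-t}$ for each $t=1,\ldots,j_i-1$. Then $f$ is a product of at most $r$ irreducible polynomials in $\mathbb{Z}[z]$. In particular, if $r=1$, then $f$ is irreducible in $\mathbb{Z}[z]$.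
   Context: For $f=a_0+\cdots+a_nz^n$ with $a_n\neq0$, the height is $h_f=\max_{0\leq i\leq n-1}|a_i|/|a_n|$. For $i=0,1,\ldots,n$, $s_i(z)=f^{(i)}(z)/i!\in\mathbb{Z}[z]$, where $f^{(i)}$ is the $i$-th formal derivative (so $s_0=f$). A polynomial is primitive if the gcd of its coefficients is $1$. For a prime $p$ and nonzero integer $a$, $v_p(a)$ is the exponent of $p$ in $a$, and $v_p(0)=\infty$. -}

module Defs where

open import Data.Nat as ℕ using (ℕ; zero; suc; _∸_; _!)
open import Data.Nat.Properties using (_!≢0)
open import Data.Integer as ℤ using (ℤ; +_; ∣_∣)
open import Data.Integer.DivMod using (_/ℕ_)
open import Data.Nat.Divisibility using (_∣_)
open import Data.Product using (Σ; ∃; _×_; _,_; proj₁)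
open import Data.Sum using (_⊎_)
open import Data.List using (List; foldr)
open import Relation.Binary.PropositionalEquality using (_≡_; refl)
open import Relation.Nullary using (¬_)

Coeffs : Set
Coeffs = ℕ → ℤ

Poly : Set
Poly = Σ Coeffs λ c → ∃ λ d → ∀ k → d ℕ.< k → c k ≡ ℤ.0ℤ

coeff : Poly → ℕ → ℤ
coeff = proj₁

_≈P_ : Poly → Poly → Set
f ≈P g = ∀ k → coeff f k ≡ coeff g k

conv : Coeffs → Coeffs → ℕ → ℕ → ℤ
conv g h k zero    = g 0 ℤ.* h k
conv g h k (suc i) = conv g h k i ℤ.+ g (suc i) ℤ.* h (k ∸ suc i)


mulC : Coeffs → Coeffs → Coeffs
mulC g h k = conv g h k k

oneC : Coeffs
oneC zero    = ℤ.1ℤ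
oneC (suc _) = ℤ.0ℤ

zeroP : Poly
zeroP = (λ _ → ℤ.0ℤ) , 0 , λ _ _ → refl

oneP : Poly
oneP = oneC , 0 , λ { zero () ; (suc k) _ → refl }

mulP : Poly → Poly → Poly
mulP (g , dg , hg) (h , dh , hh) = mulC g h , dg ℕ.+ dh , bound
  where
  open import Data.Nat.Properties
  open import Data.Integer.Properties using () renaming (*-zeroʳ to ℤ*-zeroʳ; +-identityˡ to +-identityˡℤ)
  open import Relation.Nullary using (yes; no)
  open import Relation.Binary.PropositionalEquality using (sym; trans)
  bound : ∀ k → dg ℕ.+ dh ℕ.< k → mulC g h k ≡ ℤ.0ℤ
  bound k lt = go k ≤-refl
    where
    dh<k∸si : ∀ i → suc i ℕ.≤ k → suc i ℕ.≤ dg → dh ℕ.< k ∸ suc i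
    dh<k∸si i si≤k si≤dg = +-cancelʳ-< (suc i) dh (k ∸ suc i) (begin-strict
        dh ℕ.+ suc i ≤⟨ +-monoʳ-≤ dh si≤dg ⟩
        dh ℕ.+ dg    ≡⟨ +-comm dh dg ⟩
        dg ℕ.+ dh    <⟨ lt ⟩
        k            ≡⟨ sym (m∸n+n≡m si≤k) ⟩
        k ∸ suc i ℕ.+ suc i ∎)
      where open ≤-Reasoning
    go : ∀ i → i ℕ.≤ k → conv g h k i ≡ ℤ.0ℤ
    go zero _ rewrite hh k (≤-<-trans (m≤n+m dh dg) lt) = ℤ*-zeroʳ (g 0)
    go (suc i) si≤k with dg ℕ.<? suc i
    ... | yes p rewrite go i (≤-trans (n≤1+n i) si≤k) | hg (suc i) p = refl
    ... | no p rewrite go i (≤-trans (n≤1+n i) si≤k)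
                     | hh (k ∸ suc i) (dh<k∸si i si≤k (≮⇒≥ p)) = trans (+-identityˡℤ _) (ℤ*-zeroʳ (g (suc i)))

productP : List Poly → Poly
productP = foldr mulP oneP

IsUnit : Poly → Set
IsUnit f = ∃ λ g → mulP f g ≈P oneP

Irreducible : Poly → Set
Irreducible f = ¬ (f ≈P zeroP) × ¬ IsUnit f
  × (∀ g h → f ≈P mulP g h → IsUnit g ⊎ IsUnit h)

evalUpTo : Coeffs → ℕ → ℤ → ℤ
evalUpTo c zero    x = c 0
evalUpTo c (suc n) x = evalUpTo c n x ℤ.+ c (suc n) ℤ.* (x ℤ.^ suc n)

deriv : Coeffs → Coeffs
deriv c k = + suc k ℤ.* c (suc k)

derivIter : ℕ → Coeffs → Coeffs
derivIter zero    c = c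
derivIter (suc i) c = deriv (derivIter i c)

-- s_i = f^{(i)} / i!  (coefficientwise exact division by i!)
s : Coeffs → ℕ → Coeffs
s c i k = (derivIter i c k /ℕ (i !)) {{i !≢0}}

-- s_i(m), for f of degree n (s_i has degree ≤ n - i ≤ n)
sAt : Coeffs → ℕ → ℕ → ℤ → ℤ
sAt c n i x = evalUpTo (s c i) n x

-- v_p(a) = e   (only possible for a ≠ 0; for a = 0 no e satisfies this,
-- matching v_p(0) = ∞)
Val : ℕ → ℤ → ℕ → Set
Val p a e = (p ℕ.^ e) ∣ ∣ a ∣ × ¬ ((p ℕ.^ suc e) ∣ ∣ a ∣)

Primitive : Coeffs → ℕ → Set
Primitive c n = ∀ d → (∀ k → k ℕ.≤ n → d ∣ ∣ c k ∣) → d ≡ 1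

open import Data.Fin using (Fin)
import Data.Fin as Fin

prodFin : (r : ℕ) → (Fin r → ℕ) → ℕ
prodFin zero    x = 1
prodFin (suc r) x = x Fin.zero ℕ.* prodFin r (λ i → x (Fin.suc i))

{-# OPTIONS --safe #-}

-- Write F(y) = f(y + m) and let g h = f.
-- (1) If g(m) = ±1 then g is a unit.  Otherwise 1 / g(y + m) is a power series with integer
--     coefficients that is not a polynomial, so the ℓ¹-norms of its truncations are unbounded.
--     But m ≥ h_f + 2 makes multiplication by F norm-nondecreasing on power series, and F times
--     this series is the polynomial h(y + m).
-- (2) No p_i divides both g(m) and h(m): the edge of the Newton polygon of F at p_i from (0 , k_i)
--     to (j_i , 0) has no interior lattice points, so it comes from only one of the factors.
-- Hence splitting a factor into nonunits splits the set of p_i dividing its value at m into two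
-- nonempty parts, so there are at most r irreducible factors.  Reducibility is decidable since
-- the coefficients of a divisor of f are bounded in terms of f(m), …, f(m + n) (Kronecker).

module Submission where

open import Defs
open import Data.Nat using (ℕ; zero; suc; _+_; _*_; _∸_; _^_; _≤_; _<_; z≤n; s≤s; _!; NonZero; ≢-nonZero; >-nonZero; s≤s⁻¹; nonTrivial⇒≢1; nonTrivial⇒n>1)
open import Data.Nat.Properties hiding (suc-injective)
open import Data.Nat.Divisibility hiding (quotient)
open import Data.Nat.Primality using (Prime; euclidsLemma; prime⇒nonZero; prime⇒nonTrivial; prime⇒irreducible)
open import Data.Nat.GCD using (gcd)
open import Data.Integer as ℤ using (ℤ; +_; ∣_∣; 0ℤ; 1ℤ)
import Data.Integer.Properties as ℤₚ
open import Data.Integer.Tactic.RingSolver using (solve-∀)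
open import Data.Nat.Tactic.RingSolver using () renaming (solve-∀ to ℕ-solve-∀)
open import Data.Integer.DivMod using (_/ℕ_; _%ℕ_; a≡a%ℕn+[a/ℕn]*n; n%ℕd<d)
open import Data.Nat.Coprimality as Coprime using (coprime-divisor; gcd≡1⇒coprime)
import Data.Integer.Divisibility.Signed as ℤ∣
open import Data.Empty using (⊥; ⊥-elim)
open import Relation.Binary.Definitions using (tri<; tri≈; tri>)
open import Data.Fin as Fin using (Fin)
open import Data.Fin.Properties using (suc-injective)
open import Data.List using (List; []; _∷_; length; _++_)
open import Data.List.Properties using (length-++)
open import Data.List.Relation.Unary.All using (All; []; _∷_)
open import Data.List.Relation.Unary.All.Properties using (++⁺)
open import Data.Product using (∃; _×_; _,_; proj₁; proj₂)
open import Data.Sum using (_⊎_; inj₁; inj₂; [_,_]′)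
open import Function using (_∘_)
open import Relation.Nullary using (¬_; Dec; yes; no; contradiction; ¬?; _×-dec_; _⊎-dec_)
open import Relation.Nullary.Decidable using (map′)
open import Relation.Binary.PropositionalEquality using (_≡_; _≢_; _≗_; refl; sym; trans; cong; cong₂; subst; subst₂; module ≡-Reasoning)

-- The familiar reason for (1) is that all complex roots of f satisfy |z| < h_f + 1, so each lies at
-- distance more than 1 from m and |g(m)| > 1 for a nonconstant factor g. The ℓ¹ estimate says the
-- same without roots: if g(m) = ±1, some root of g(y + m) would lie in the closed unit disc, and
-- what remains visible of it over the integers is that 1 / g(y + m) has infinitely many nonzero
-- integer coefficients. For (2) no polygon is constructed. Its edge is replaced by a linear form on
-- points (index, valuation) that is constant along the edge, and by a Gauss lemma for the minima of
-- that form; lattice points enter only as a divisibility by j_i. The list of factors has to be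
-- computed, so being a nonunit must be testable: by (1) the test is that the value at m is not ±1.
-- Kronecker's bound also requires f(m + i) to be nonzero at all sample points, which the ℓ¹
-- estimate at m + i supplies.

tail : Coeffs → Coeffs
tail c k = c (suc k)

0̂ : Coeffs
0̂ _ = 0ℤ

cst : ℤ → Coeffs
cst x zero    = x
cst x (suc _) = 0ℤ

infixl 6 _⊕_
infixl 7 _·_

_⊕_ : Coeffs → Coeffs → Coeffs
(c ⊕ c′) k = c k ℤ.+ c′ k

_·_ : ℤ → Coeffs → Coeffs
(x · c) k = x ℤ.* c k

-- Multiplication by the linear polynomial y + x.
lin : ℤ → Coeffs → Coeffs
lin x u zero    = x ℤ.* u zero
lin x u (suc k) = x ℤ.* u (suc k) ℤ.+ u k

-- Ring laws for convolution of coefficient sequences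

-- `conv` recurses on its last summand. Splitting off the first one gives the Horner form g·h =
-- g(0)·h + y·(tail g)·h, on which the ring laws below are proved by induction on the coefficient
-- index.
conv-suc : ∀ g h k i → conv g h (suc k) (suc i) ≡ g 0 ℤ.* h (suc k) ℤ.+ conv (tail g) h k i
conv-suc g h k zero    = refl
conv-suc g h k (suc i) = trans (cong (ℤ._+ t) (conv-suc g h k i)) (ℤₚ.+-assoc (g 0 ℤ.* h (suc k)) (conv (tail g) h k i) t)
  where t = g (suc (suc i)) ℤ.* h (k ∸ suc i)

mulC-suc : ∀ g h k → mulC g h (suc k) ≡ g 0 ℤ.* h (suc k) ℤ.+ mulC (tail g) h k
mulC-suc g h k = conv-suc g h k k

mulC-cong : ∀ {g g′ h h′} → g ≗ g′ → h ≗ h′ → mulC g h ≗ mulC g′ h′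
mulC-cong e f zero = cong₂ ℤ._*_ (e 0) (f 0)
mulC-cong {g} {g′} {h} {h′} e f (suc k) = begin
  mulC g h (suc k)                                ≡⟨ mulC-suc g h k ⟩
  g 0 ℤ.* h (suc k) ℤ.+ mulC (tail g) h k         ≡⟨ cong₂ ℤ._+_ (cong₂ ℤ._*_ (e 0) (f (suc k))) (mulC-cong (e ∘ suc) f k) ⟩
  g′ 0 ℤ.* h′ (suc k) ℤ.+ mulC (tail g′) h′ k     ≡⟨ mulC-suc g′ h′ k ⟨
  mulC g′ h′ (suc k)                              ∎
  where open ≡-Reasoning

mulC-sucʳ : ∀ g h k → mulC g h (suc k) ≡ g (suc k) ℤ.* h 0 ℤ.+ mulC g (tail h) k
mulC-sucʳ g h zero    = ℤₚ.+-comm (g 0 ℤ.* h 1) (g 1 ℤ.* h 0)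
mulC-sucʳ g h (suc k) = begin
  mulC g h (suc (suc k))                        ≡⟨ mulC-suc g h (suc k) ⟩
  a ℤ.+ mulC (tail g) h (suc k)                 ≡⟨ cong (ℤ._+_ a) (mulC-sucʳ (tail g) h k) ⟩
  a ℤ.+ (b ℤ.+ mulC (tail g) (tail h) k)        ≡⟨ swap a b _ ⟩
  b ℤ.+ (a ℤ.+ mulC (tail g) (tail h) k)        ≡⟨ cong (ℤ._+_ b) (mulC-suc g (tail h) k) ⟨
  b ℤ.+ mulC g (tail h) (suc k)                 ∎
  where
  open ≡-Reasoning
  a = g 0 ℤ.* h (suc (suc k))
  b = g (suc (suc k)) ℤ.* h 0
  swap : ∀ a b c → a ℤ.+ (b ℤ.+ c) ≡ b ℤ.+ (a ℤ.+ c)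
  swap = solve-∀

mulC-comm : ∀ g h → mulC g h ≗ mulC h g
mulC-comm g h zero    = ℤₚ.*-comm (g 0) (h 0)
mulC-comm g h (suc k) = begin
  mulC g h (suc k)                             ≡⟨ mulC-suc g h k ⟩
  g 0 ℤ.* h (suc k) ℤ.+ mulC (tail g) h k      ≡⟨ cong₂ ℤ._+_ (ℤₚ.*-comm (g 0) (h (suc k))) (mulC-comm (tail g) h k) ⟩
  h (suc k) ℤ.* g 0 ℤ.+ mulC h (tail g) k      ≡⟨ mulC-sucʳ h g k ⟨
  mulC h g (suc k)                             ∎
  where open ≡-Reasoning

mulC-zeroˡ : ∀ {g} h → g ≗ 0̂ → mulC g h ≗ 0̂
mulC-zeroˡ h e zero    = cong (ℤ._* h 0) (e 0)
mulC-zeroˡ {g} h e (suc k) = trans (mulC-suc g h k) (cong₂ ℤ._+_ (cong (ℤ._* h (suc k)) (e 0)) (mulC-zeroˡ h (e ∘ suc) k))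

mulC-⊕ˡ : ∀ g g′ h → mulC (g ⊕ g′) h ≗ mulC g h ⊕ mulC g′ h
mulC-⊕ˡ g g′ h zero    = ℤₚ.*-distribʳ-+ (h 0) (g 0) (g′ 0)
mulC-⊕ˡ g g′ h (suc k) = begin
  mulC (g ⊕ g′) h (suc k)   ≡⟨ mulC-suc (g ⊕ g′) h k ⟩
  (g 0 ℤ.+ g′ 0) ℤ.* h (suc k) ℤ.+ mulC (tail g ⊕ tail g′) h k
    ≡⟨ cong (ℤ._+_ ((g 0 ℤ.+ g′ 0) ℤ.* h (suc k))) (mulC-⊕ˡ (tail g) (tail g′) h k) ⟩
  (g 0 ℤ.+ g′ 0) ℤ.* h (suc k) ℤ.+ (mulC (tail g) h k ℤ.+ mulC (tail g′) h k)
    ≡⟨ rearrange (g 0) (g′ 0) (h (suc k)) _ _ ⟩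
  (g 0 ℤ.* h (suc k) ℤ.+ mulC (tail g) h k) ℤ.+ (g′ 0 ℤ.* h (suc k) ℤ.+ mulC (tail g′) h k)
    ≡⟨ cong₂ ℤ._+_ (mulC-suc g h k) (mulC-suc g′ h k) ⟨
  (mulC g h ⊕ mulC g′ h) (suc k) ∎
  where
  open ≡-Reasoning
  rearrange : ∀ a b c d e → (a ℤ.+ b) ℤ.* c ℤ.+ (d ℤ.+ e) ≡ (a ℤ.* c ℤ.+ d) ℤ.+ (b ℤ.* c ℤ.+ e)
  rearrange = solve-∀

mulC-·ˡ : ∀ x g h → mulC (x · g) h ≗ x · mulC g h
mulC-·ˡ x g h zero    = ℤₚ.*-assoc x (g 0) (h 0)
mulC-·ˡ x g h (suc k) = begin
  mulC (x · g) h (suc k)                                       ≡⟨ mulC-suc (x · g) h k ⟩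
  x ℤ.* g 0 ℤ.* h (suc k) ℤ.+ mulC (x · tail g) h k             ≡⟨ cong (ℤ._+_ (x ℤ.* g 0 ℤ.* h (suc k))) (mulC-·ˡ x (tail g) h k) ⟩
  x ℤ.* g 0 ℤ.* h (suc k) ℤ.+ x ℤ.* mulC (tail g) h k           ≡⟨ factor x (g 0) (h (suc k)) _ ⟩
  x ℤ.* (g 0 ℤ.* h (suc k) ℤ.+ mulC (tail g) h k)               ≡⟨ cong (ℤ._*_ x) (mulC-suc g h k) ⟨
  x ℤ.* mulC g h (suc k)                                       ∎
  where
  open ≡-Reasoning
  factor : ∀ x a b c → x ℤ.* a ℤ.* b ℤ.+ x ℤ.* c ≡ x ℤ.* (a ℤ.* b ℤ.+ c)
  factor = solve-∀

mulC-assoc : ∀ g h l → mulC (mulC g h) l ≗ mulC g (mulC h l)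
mulC-assoc g h l zero    = ℤₚ.*-assoc (g 0) (h 0) (l 0)
mulC-assoc g h l (suc k) = begin
  mulC (mulC g h) l (suc k)
    ≡⟨ mulC-suc (mulC g h) l k ⟩
  g 0 ℤ.* h 0 ℤ.* l (suc k) ℤ.+ mulC (tail (mulC g h)) l k
    ≡⟨ cong (ℤ._+_ (g 0 ℤ.* h 0 ℤ.* l (suc k))) (trans (mulC-cong {h = l} (mulC-suc g h) (λ _ → refl) k) (mulC-⊕ˡ (g 0 · tail h) (mulC (tail g) h) l k)) ⟩
  g 0 ℤ.* h 0 ℤ.* l (suc k) ℤ.+ (mulC (g 0 · tail h) l k ℤ.+ mulC (mulC (tail g) h) l k)
    ≡⟨ cong (ℤ._+_ (g 0 ℤ.* h 0 ℤ.* l (suc k))) (cong₂ ℤ._+_ (mulC-·ˡ (g 0) (tail h) l k) (mulC-assoc (tail g) h l k)) ⟩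
  g 0 ℤ.* h 0 ℤ.* l (suc k) ℤ.+ (g 0 ℤ.* mulC (tail h) l k ℤ.+ mulC (tail g) (mulC h l) k)
    ≡⟨ factor (g 0) (h 0) (l (suc k)) _ _ ⟩
  g 0 ℤ.* (h 0 ℤ.* l (suc k) ℤ.+ mulC (tail h) l k) ℤ.+ mulC (tail g) (mulC h l) k
    ≡⟨ cong (λ z → g 0 ℤ.* z ℤ.+ mulC (tail g) (mulC h l) k) (mulC-suc h l k) ⟨
  g 0 ℤ.* mulC h l (suc k) ℤ.+ mulC (tail g) (mulC h l) k
    ≡⟨ mulC-suc g (mulC h l) k ⟨
  mulC g (mulC h l) (suc k) ∎
  where
  open ≡-Reasoning
  factor : ∀ a b c d e → a ℤ.* b ℤ.* c ℤ.+ (a ℤ.* d ℤ.+ e) ≡ a ℤ.* (b ℤ.* c ℤ.+ d) ℤ.+ e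
  factor = solve-∀

mulC-cst : ∀ x h → mulC (cst x) h ≗ x · h
mulC-cst x h zero    = refl
mulC-cst x h (suc k) = trans (mulC-suc (cst x) h k)
  (trans (cong (ℤ._+_ (x ℤ.* h (suc k))) (mulC-zeroˡ h (λ _ → refl) k)) (ℤₚ.+-identityʳ _))

mulC-oneˡ : ∀ h → mulC oneC h ≗ h
mulC-oneˡ h k = trans (mulC-cong {h = h} (λ { zero → refl ; (suc _) → refl }) (λ _ → refl) k)
  (trans (mulC-cst 1ℤ h k) (ℤₚ.*-identityˡ (h k)))

mulC-oneʳ : ∀ h → mulC h oneC ≗ h
mulC-oneʳ h k = trans (mulC-comm h oneC k) (mulC-oneˡ h k)

mulC-linˡ : ∀ x g h → mulC (lin x g) h ≗ lin x (mulC g h)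
mulC-linˡ x g h zero    = ℤₚ.*-assoc x (g 0) (h 0)
mulC-linˡ x g h (suc k) = begin
  mulC (lin x g) h (suc k)
    ≡⟨ mulC-suc (lin x g) h k ⟩
  x ℤ.* g 0 ℤ.* h (suc k) ℤ.+ mulC (x · tail g ⊕ g) h k
    ≡⟨ cong (ℤ._+_ (x ℤ.* g 0 ℤ.* h (suc k))) (trans (mulC-⊕ˡ (x · tail g) g h k) (cong (ℤ._+ mulC g h k) (mulC-·ˡ x (tail g) h k))) ⟩
  x ℤ.* g 0 ℤ.* h (suc k) ℤ.+ (x ℤ.* mulC (tail g) h k ℤ.+ mulC g h k)
    ≡⟨ factor x (g 0) (h (suc k)) _ _ ⟩
  x ℤ.* (g 0 ℤ.* h (suc k) ℤ.+ mulC (tail g) h k) ℤ.+ mulC g h k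
    ≡⟨ cong (λ z → x ℤ.* z ℤ.+ mulC g h k) (mulC-suc g h k) ⟨
  lin x (mulC g h) (suc k) ∎
  where
  open ≡-Reasoning
  factor : ∀ x a b c d → x ℤ.* a ℤ.* b ℤ.+ (x ℤ.* c ℤ.+ d) ≡ x ℤ.* (a ℤ.* b ℤ.+ c) ℤ.+ d
  factor = solve-∀

lin-cong : ∀ x {u v} → u ≗ v → lin x u ≗ lin x v
lin-cong x e zero    = cong (ℤ._*_ x) (e 0)
lin-cong x e (suc k) = cong₂ (λ a b → x ℤ.* a ℤ.+ b) (e (suc k)) (e k)

lin-⊕ : ∀ x u v → lin x (u ⊕ v) ≗ lin x u ⊕ lin x v
lin-⊕ x u v zero    = ℤₚ.*-distribˡ-+ x (u 0) (v 0)
lin-⊕ x u v (suc k) = rearrange x (u (suc k)) (v (suc k)) (u k) (v k)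
  where
  rearrange : ∀ x a b c d → x ℤ.* (a ℤ.+ b) ℤ.+ (c ℤ.+ d) ≡ (x ℤ.* a ℤ.+ c) ℤ.+ (x ℤ.* b ℤ.+ d)
  rearrange = solve-∀

lin-· : ∀ x y u → lin x (y · u) ≗ y · lin x u
lin-· x y u zero    = swap x y (u 0)
  where
  swap : ∀ x y a → x ℤ.* (y ℤ.* a) ≡ y ℤ.* (x ℤ.* a)
  swap = solve-∀
lin-· x y u (suc k) = swap x y (u (suc k)) (u k)
  where
  swap : ∀ x y a b → x ℤ.* (y ℤ.* a) ℤ.+ y ℤ.* b ≡ y ℤ.* (x ℤ.* a ℤ.+ b)
  swap = solve-∀

lin-zero : ∀ x → lin x 0̂ ≗ 0̂
lin-zero x zero    = ℤₚ.*-zeroʳ x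
lin-zero x (suc k) = cong (ℤ._+ 0ℤ) (ℤₚ.*-zeroʳ x)

-- Taylor expansion at an integer point

-- L is a length: a polynomial of degree d satisfies Z (suc d).
Z : ℕ → Coeffs → Set
Z L c = ∀ k → L ≤ k → c k ≡ 0ℤ

Z-tail : ∀ {L} c → Z (suc L) c → Z L (tail c)
Z-tail c z k L≤k = z (suc k) (s≤s L≤k)

Z-mono : ∀ {L L′ c} → L ≤ L′ → Z L c → Z L′ c
Z-mono L≤L′ z k L′≤k = z k (≤-trans L≤L′ L′≤k)

-- T x L c is the Taylor expansion at x of the polynomial c₀ + ⋯ + c_{L-1} z^{L-1}.
T : ℤ → ℕ → Coeffs → Coeffs
T x zero    c = 0̂
T x (suc L) c = cst (c 0) ⊕ lin x (T x L (tail c))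

T-cong : ∀ x L {c c′} → c ≗ c′ → T x L c ≗ T x L c′
T-cong x zero    e k = refl
T-cong x (suc L) {c} {c′} e k = cong₂ ℤ._+_ (cong (λ z → cst z k) (e 0)) (lin-cong x (T-cong x L (e ∘ suc)) k)

T-zero : ∀ x L {c} → c ≗ 0̂ → T x L c ≗ 0̂
T-zero x zero    e k = refl
T-zero x (suc L) e k = cong₂ ℤ._+_ (trans (cong (λ z → cst z k) (e 0)) (cst-zero k)) (trans (lin-cong x (T-zero x L (e ∘ suc)) k) (lin-zero x k))
  where
  cst-zero : cst 0ℤ ≗ 0̂
  cst-zero zero    = refl
  cst-zero (suc _) = refl

T-⊕ : ∀ x L c c′ → T x L (c ⊕ c′) ≗ T x L c ⊕ T x L c′
T-⊕ x zero    c c′ k = refl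
T-⊕ x (suc L) c c′ k = begin
  cst (c 0 ℤ.+ c′ 0) k ℤ.+ lin x (T x L (tail c ⊕ tail c′)) k
    ≡⟨ cong₂ ℤ._+_ (cst-+ k) (trans (lin-cong x (T-⊕ x L (tail c) (tail c′)) k) (lin-⊕ x (T x L (tail c)) (T x L (tail c′)) k)) ⟩
  (cst (c 0) k ℤ.+ cst (c′ 0) k) ℤ.+ (lin x (T x L (tail c)) k ℤ.+ lin x (T x L (tail c′)) k)
    ≡⟨ interchange (cst (c 0) k) _ _ _ ⟩
  (T x (suc L) c ⊕ T x (suc L) c′) k ∎
  where
  open ≡-Reasoning
  cst-+ : cst (c 0 ℤ.+ c′ 0) ≗ cst (c 0) ⊕ cst (c′ 0)
  cst-+ zero    = refl
  cst-+ (suc _) = refl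
  interchange : ∀ a b c d → (a ℤ.+ b) ℤ.+ (c ℤ.+ d) ≡ (a ℤ.+ c) ℤ.+ (b ℤ.+ d)
  interchange = solve-∀

T-· : ∀ x L y c → T x L (y · c) ≗ y · T x L c
T-· x zero    y c k = sym (ℤₚ.*-zeroʳ y)
T-· x (suc L) y c k = begin
  cst (y ℤ.* c 0) k ℤ.+ lin x (T x L (y · tail c)) k
    ≡⟨ cong₂ ℤ._+_ (cst-* k) (trans (lin-cong x (T-· x L y (tail c)) k) (lin-· x y (T x L (tail c)) k)) ⟩
  y ℤ.* cst (c 0) k ℤ.+ y ℤ.* lin x (T x L (tail c)) k
    ≡⟨ ℤₚ.*-distribˡ-+ y (cst (c 0) k) _ ⟨
  y ℤ.* T x (suc L) c k ∎
  where
  open ≡-Reasoning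
  cst-* : cst (y ℤ.* c 0) ≗ y · cst (c 0)
  cst-* zero    = refl
  cst-* (suc _) = sym (ℤₚ.*-zeroʳ y)

T-length : ∀ x {L L′ c} → L ≤ L′ → Z L c → T x L′ c ≗ T x L c
T-length x {zero} {L′} z≤n     z = T-zero x L′ (λ i → z i z≤n)
T-length x {c = c}     (s≤s l) z k = cong (ℤ._+_ (cst (c 0) k)) (lin-cong x (T-length x {c = tail c} l (Z-tail c z)) k)

T-mulC : ∀ x {L L′} g h → Z L g → Z L′ h → T x (L + L′) (mulC g h) ≗ mulC (T x L g) (T x L′ h)
T-mulC x {zero} {L′} g h zg zh k = trans (T-zero x L′ (mulC-zeroˡ h (λ i → zg i z≤n)) k)
  (sym (mulC-zeroˡ (T x L′ h) (λ _ → refl) k))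
T-mulC x {suc L} {L′} g h zg zh k = begin
  cst (g 0 ℤ.* h 0) k ℤ.+ lin x (T x M (tail (mulC g h))) k
    ≡⟨ cong (ℤ._+_ (cst (g 0 ℤ.* h 0) k)) (lin-cong x split k) ⟩
  cst (g 0 ℤ.* h 0) k ℤ.+ lin x (g 0 · T x M (tail h) ⊕ V) k
    ≡⟨ cong₂ ℤ._+_ (cst-* k) (trans (lin-⊕ x (g 0 · T x M (tail h)) V k) (cong (ℤ._+ lin x V k) (lin-· x (g 0) (T x M (tail h)) k))) ⟩
  g 0 ℤ.* cst (h 0) k ℤ.+ (g 0 ℤ.* lin x (T x M (tail h)) k ℤ.+ lin x V k)
    ≡⟨ factor (g 0) (cst (h 0) k) _ _ ⟩
  g 0 ℤ.* T x (suc M) h k ℤ.+ lin x V k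
    ≡⟨ cong (λ z → g 0 ℤ.* z ℤ.+ lin x V k) (T-length x (≤-trans (m≤n+m L′ L) (n≤1+n M)) zh k) ⟩
  g 0 ℤ.* T x L′ h k ℤ.+ lin x V k
    ≡⟨ cong₂ ℤ._+_ (mulC-cst (g 0) (T x L′ h) k) (mulC-linˡ x (T x L (tail g)) (T x L′ h) k) ⟨
  mulC (cst (g 0)) (T x L′ h) k ℤ.+ mulC (lin x (T x L (tail g))) (T x L′ h) k
    ≡⟨ mulC-⊕ˡ (cst (g 0)) (lin x (T x L (tail g))) (T x L′ h) k ⟨
  mulC (T x (suc L) g) (T x L′ h) k ∎
  where
  open ≡-Reasoning
  M = L + L′
  V = mulC (T x L (tail g)) (T x L′ h)
  split : T x M (tail (mulC g h)) ≗ g 0 · T x M (tail h) ⊕ V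
  split i = trans (T-cong x M (mulC-suc g h) i)
    (trans (T-⊕ x M (g 0 · tail h) (mulC (tail g) h) i)
      (cong₂ ℤ._+_ (T-· x M (g 0) (tail h) i) (T-mulC x {L} {L′} (tail g) h (Z-tail g zg) zh i)))
  cst-* : cst (g 0 ℤ.* h 0) ≗ g 0 · cst (h 0)
  cst-* zero    = refl
  cst-* (suc _) = sym (ℤₚ.*-zeroʳ (g 0))
  factor : ∀ a b c d → a ℤ.* b ℤ.+ (a ℤ.* c ℤ.+ d) ≡ a ℤ.* (b ℤ.+ c) ℤ.+ d
  factor = solve-∀

Z-T : ∀ x {L c} → Z L (T x L c)
Z-T x {zero}  k       _         = refl
Z-T x {suc L} {c} (suc k) (s≤s L≤k) = begin
  0ℤ ℤ.+ (x ℤ.* T x L (tail c) (suc k) ℤ.+ T x L (tail c) k)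
    ≡⟨ cong₂ (λ a b → 0ℤ ℤ.+ (x ℤ.* a ℤ.+ b)) (Z-T x (suc k) (m≤n⇒m≤1+n L≤k)) (Z-T x k L≤k) ⟩
  0ℤ ℤ.+ (x ℤ.* 0ℤ ℤ.+ 0ℤ)
    ≡⟨ cong (λ a → 0ℤ ℤ.+ (a ℤ.+ 0ℤ)) (ℤₚ.*-zeroʳ x) ⟩
  0ℤ ∎
  where open ≡-Reasoning

T-leading : ∀ x d c → T x (suc d) c d ≡ c d
T-leading x zero c = trans (cong (ℤ._+_ (c 0)) (ℤₚ.*-zeroʳ x)) (ℤₚ.+-identityʳ (c 0))
T-leading x (suc d) c = begin
  0ℤ ℤ.+ (x ℤ.* T x (suc d) (tail c) (suc d) ℤ.+ T x (suc d) (tail c) d)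
    ≡⟨ cong₂ (λ a b → 0ℤ ℤ.+ (x ℤ.* a ℤ.+ b)) (Z-T x {c = tail c} (suc d) ≤-refl) (T-leading x d (tail c)) ⟩
  0ℤ ℤ.+ (x ℤ.* 0ℤ ℤ.+ c (suc d))
    ≡⟨ drop x (c (suc d)) ⟩
  c (suc d) ∎
  where
  open ≡-Reasoning
  drop : ∀ x a → 0ℤ ℤ.+ (x ℤ.* 0ℤ ℤ.+ a) ≡ a
  drop = solve-∀

Z-mulC : ∀ {L L′} g h → Z L g → Z L′ h → Z (L + L′) (mulC g h)
Z-mulC {zero}  g h zg zh k le = mulC-zeroˡ h (λ i → zg i z≤n) k
Z-mulC {suc L} {L′} g h zg zh (suc k) (s≤s le) = trans (mulC-suc g h k) (cong₂ ℤ._+_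
  (trans (cong (g 0 ℤ.*_) (zh (suc k) (m≤n⇒m≤1+n (≤-trans (m≤n+m L′ L) le)))) (ℤₚ.*-zeroʳ (g 0)))
  (Z-mulC (tail g) h (Z-tail g zg) zh k le))

-- Values and normalised derivatives as Taylor coefficients

evalUpTo-suc : ∀ c n x → evalUpTo c (suc n) x ≡ c 0 ℤ.+ x ℤ.* evalUpTo (tail c) n x
evalUpTo-suc c zero    x = simp (c 0) (c 1) x
  where
  simp : ∀ a b x → a ℤ.+ b ℤ.* (x ℤ.* 1ℤ) ≡ a ℤ.+ x ℤ.* b
  simp = solve-∀
evalUpTo-suc c (suc n) x = begin
  evalUpTo c (suc n) x ℤ.+ c (suc (suc n)) ℤ.* (x ℤ.* x ℤ.^ suc n)
    ≡⟨ cong (ℤ._+ c (suc (suc n)) ℤ.* (x ℤ.* x ℤ.^ suc n)) (evalUpTo-suc c n x) ⟩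
  c 0 ℤ.+ x ℤ.* evalUpTo (tail c) n x ℤ.+ c (suc (suc n)) ℤ.* (x ℤ.* x ℤ.^ suc n)
    ≡⟨ factor (c 0) x (evalUpTo (tail c) n x) (c (suc (suc n))) (x ℤ.^ suc n) ⟩
  c 0 ℤ.+ x ℤ.* (evalUpTo (tail c) n x ℤ.+ c (suc (suc n)) ℤ.* x ℤ.^ suc n) ∎
  where
  open ≡-Reasoning
  factor : ∀ a x b c d → a ℤ.+ x ℤ.* b ℤ.+ c ℤ.* (x ℤ.* d) ≡ a ℤ.+ x ℤ.* (b ℤ.+ c ℤ.* d)
  factor = solve-∀

evalUpTo≡T : ∀ c n x → evalUpTo c n x ≡ T x (suc n) c 0
evalUpTo≡T c zero    x = sym (trans (cong (ℤ._+_ (c 0)) (ℤₚ.*-zeroʳ x)) (ℤₚ.+-identityʳ (c 0)))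
evalUpTo≡T c (suc n) x = trans (evalUpTo-suc c n x) (cong (λ z → c 0 ℤ.+ x ℤ.* z) (evalUpTo≡T (tail c) n x))

-- B t k is the binomial coefficient (t + k choose t).
B : ℕ → ℕ → ℕ
B zero    k       = 1
B (suc t) zero    = 1
B (suc t) (suc k) = B t (suc k) + B (suc t) k

B-zeroʳ : ∀ t → B t 0 ≡ 1
B-zeroʳ zero    = refl
B-zeroʳ (suc t) = refl

-- The absorption identity trades the factor k + 1 produced by `deriv` for the factor t + 1 that
-- turns t! into (t + 1)!.
B-absorb : ∀ t k → suc t * B (suc t) k ≡ suc k * B t (suc k)
B-absorb zero    zero    = refl
B-absorb (suc t) zero    = trans (cong suc (B-absorb t zero)) (reorder (B t 1))
  where
  reorder : ∀ b → 1 + 1 * b ≡ 1 * (b + 1)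
  reorder = ℕ-solve-∀
B-absorb zero    (suc k) = begin
  1 * (1 + B 1 k)          ≡⟨ cong (λ z → 1 * 1 + z) (B-absorb zero k) ⟩
  1 + suc k * 1            ≡⟨⟩
  suc (suc k) * 1          ∎
  where open ≡-Reasoning
B-absorb (suc t) (suc k) = begin
  suc (suc t) * (b + B (suc (suc t)) k)               ≡⟨ *-distribˡ-+ (suc (suc t)) b _ ⟩
  suc (suc t) * b + suc (suc t) * B (suc (suc t)) k   ≡⟨ cong (_+_ (suc (suc t) * b)) (B-absorb (suc t) k) ⟩
  suc (suc t) * b + suc k * b                         ≡⟨ reorder t k b ⟩
  suc (suc k) * b + suc t * b                         ≡⟨ cong (_+_ (suc (suc k) * b)) (B-absorb t (suc k)) ⟩
  suc (suc k) * b + suc (suc k) * B t (suc (suc k))   ≡⟨ factor k b (B t (suc (suc k))) ⟩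
  suc (suc k) * (B t (suc (suc k)) + b)               ∎
  where
  open ≡-Reasoning
  b = B (suc t) (suc k)
  reorder : ∀ t k b → suc (suc t) * b + suc k * b ≡ suc (suc k) * b + suc t * b
  reorder = ℕ-solve-∀
  factor : ∀ k b c → suc (suc k) * b + suc (suc k) * c ≡ suc (suc k) * (c + b)
  factor = ℕ-solve-∀

hasse : Coeffs → ℕ → Coeffs
hasse c t k = + B t k ℤ.* c (t + k)

derivIter-hasse : ∀ t c k → derivIter t c k ≡ hasse c t k ℤ.* + (t !)
derivIter-hasse zero    c k = simp (c k)
  where
  simp : ∀ a → a ≡ 1ℤ ℤ.* a ℤ.* 1ℤ
  simp = solve-∀
derivIter-hasse (suc t) c k = begin
  + suc k ℤ.* derivIter t c (suc k)
    ≡⟨ cong (+ suc k ℤ.*_) (derivIter-hasse t c (suc k)) ⟩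
  + suc k ℤ.* (+ B t (suc k) ℤ.* c (t + suc k) ℤ.* + (t !))
    ≡⟨ assoc (+ suc k) (+ B t (suc k)) (c (t + suc k)) (+ (t !)) ⟩
  (+ suc k ℤ.* + B t (suc k)) ℤ.* c (t + suc k) ℤ.* + (t !)
    ≡⟨ cong₂ (λ a b → a ℤ.* b ℤ.* + (t !)) absorb (cong c (+-suc t k)) ⟩
  (+ suc t ℤ.* + B (suc t) k) ℤ.* c (suc t + k) ℤ.* + (t !)
    ≡⟨ move (+ suc t) (+ B (suc t) k) (c (suc t + k)) (+ (t !)) ⟩
  + B (suc t) k ℤ.* c (suc t + k) ℤ.* (+ suc t ℤ.* + (t !))
    ≡⟨ cong (hasse c (suc t) k ℤ.*_) (ℤₚ.pos-* (suc t) (t !)) ⟨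
  hasse c (suc t) k ℤ.* + (suc t !) ∎
  where
  open ≡-Reasoning
  absorb : + suc k ℤ.* + B t (suc k) ≡ + suc t ℤ.* + B (suc t) k
  absorb = trans (sym (ℤₚ.pos-* (suc k) (B t (suc k)))) (trans (cong +_ (sym (B-absorb t k))) (ℤₚ.pos-* (suc t) (B (suc t) k)))
  assoc : ∀ a b c d → a ℤ.* (b ℤ.* c ℤ.* d) ≡ (a ℤ.* b) ℤ.* c ℤ.* d
  assoc = solve-∀
  move : ∀ a b c d → (a ℤ.* b) ℤ.* c ℤ.* d ≡ b ℤ.* c ℤ.* (a ℤ.* d)
  move = solve-∀

-- With quotient q, the number (m - q)·d is the remainder of the division. It is smaller than d, so
-- m - q vanishes.
m*d/ℕd≡m : ∀ m d .{{_ : NonZero d}} → (m ℤ.* + d) /ℕ d ≡ m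
m*d/ℕd≡m m d = sym (ℤₚ.i-j≡0⇒i≡j m q (ℤₚ.∣i∣≡0⇒i≡0 (n<1⇒n≡0 (*-cancelʳ-< d ∣ m ℤ.- q ∣ 1 small))))
  where
  q = (m ℤ.* + d) /ℕ d
  r = (m ℤ.* + d) %ℕ d
  rearrange : ∀ m q d r → m ℤ.* d ≡ r ℤ.+ q ℤ.* d → (m ℤ.- q) ℤ.* d ≡ r
  rearrange m q d r e = trans (distrib m q d) (trans (cong (ℤ._- q ℤ.* d) e) (cancel r (q ℤ.* d)))
    where
    distrib : ∀ m q d → (m ℤ.- q) ℤ.* d ≡ m ℤ.* d ℤ.- q ℤ.* d
    distrib = solve-∀
    cancel : ∀ a b → a ℤ.+ b ℤ.- b ≡ a
    cancel = solve-∀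
  small : ∣ m ℤ.- q ∣ * d < 1 * d
  small = subst (_< 1 * d)
    (trans (cong ∣_∣ (sym (rearrange m q (+ d) (+ r) (a≡a%ℕn+[a/ℕn]*n (m ℤ.* + d) d)))) (ℤₚ.abs-* (m ℤ.- q) (+ d)))
    (subst (r <_) (sym (*-identityˡ d)) (n%ℕd<d (m ℤ.* + d) d))

s≗hasse : ∀ c t → s c t ≗ hasse c t
s≗hasse c t k = trans (cong (λ z → (z /ℕ (t !)) {{t !≢0}}) (derivIter-hasse t c k)) (m*d/ℕd≡m (hasse c t k) (t !) {{t !≢0}})

-- Write c = c(0) + z·c₁ and D for the normalised derivatives. Pascal's rule for `B` is the Leibniz
-- rule D_{t+1}(z·c₁) = z·D_{t+1}c₁ + D_t c₁, and at z = x this is the recursion that `lin x`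
-- imposes on Taylor coefficients.
T-hasse : ∀ x L c t → Z L c → T x L (hasse c t) 0 ≡ T x L c t
T-hasse x zero    c t       z = refl
T-hasse x (suc L) c zero    z = cong₂ (λ a b → a ℤ.+ x ℤ.* b) (ℤₚ.*-identityˡ (c 0)) (T-hasse x L (tail c) zero (Z-tail c z))
T-hasse x (suc L) c (suc t) z = begin
  + 1 ℤ.* c (suc t + 0) ℤ.+ x ℤ.* T x L (tail (hasse c (suc t))) 0
    ≡⟨ cong (λ w → + 1 ℤ.* c (suc t + 0) ℤ.+ x ℤ.* w) pascal ⟩
  + 1 ℤ.* c (suc t + 0) ℤ.+ x ℤ.* (T x L (tail (hasse c₁ t)) 0 ℤ.+ T x L (hasse c₁ (suc t)) 0)
    ≡⟨ distrib (+ 1 ℤ.* c (suc t + 0)) x (T x L (tail (hasse c₁ t)) 0) (T x L (hasse c₁ (suc t)) 0) ⟩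
  x ℤ.* T x L (hasse c₁ (suc t)) 0 ℤ.+ (+ 1 ℤ.* c (suc t + 0) ℤ.+ x ℤ.* T x L (tail (hasse c₁ t)) 0)
    ≡⟨ cong (λ w → x ℤ.* T x L (hasse c₁ (suc t)) 0 ℤ.+ (+ w ℤ.* c (suc t + 0) ℤ.+ x ℤ.* T x L (tail (hasse c₁ t)) 0)) (B-zeroʳ t) ⟨
  x ℤ.* T x L (hasse c₁ (suc t)) 0 ℤ.+ T x (suc L) (hasse c₁ t) 0
    ≡⟨ cong (λ w → x ℤ.* T x L (hasse c₁ (suc t)) 0 ℤ.+ w) (T-length x {L} {suc L} {hasse c₁ t} (n≤1+n L) zh 0) ⟩
  x ℤ.* T x L (hasse c₁ (suc t)) 0 ℤ.+ T x L (hasse c₁ t) 0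
    ≡⟨ cong₂ (λ a b → x ℤ.* a ℤ.+ b) (T-hasse x L c₁ (suc t) (Z-tail c z)) (T-hasse x L c₁ t (Z-tail c z)) ⟩
  x ℤ.* T x L c₁ (suc t) ℤ.+ T x L c₁ t
    ≡⟨ ℤₚ.+-identityˡ _ ⟨
  T x (suc L) c (suc t) ∎
  where
  open ≡-Reasoning
  c₁ = tail c
  distrib : ∀ a x b d → a ℤ.+ x ℤ.* (b ℤ.+ d) ≡ x ℤ.* d ℤ.+ (a ℤ.+ x ℤ.* b)
  distrib = solve-∀
  zh : Z L (hasse c₁ t)
  zh k L≤k = trans (cong (+ B t k ℤ.*_) (z (suc (t + k)) (s≤s (≤-trans L≤k (m≤n+m k t))))) (ℤₚ.*-zeroʳ (+ B t k))
  pascal : T x L (tail (hasse c (suc t))) 0 ≡ T x L (tail (hasse c₁ t)) 0 ℤ.+ T x L (hasse c₁ (suc t)) 0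
  pascal = trans (T-cong x L {tail (hasse c (suc t))} {tail (hasse c₁ t) ⊕ hasse c₁ (suc t)} (λ k →
      trans (ℤₚ.*-distribʳ-+ (c (suc t + suc k)) (+ B t (suc k)) (+ B (suc t) k))
            (cong (λ w → + B t (suc k) ℤ.* c (suc t + suc k) ℤ.+ + B (suc t) k ℤ.* c (suc w)) (+-suc t k))) 0)
    (T-⊕ x L (tail (hasse c₁ t)) (hasse c₁ (suc t)) 0)

sAt≡T : ∀ x n c t → Z (suc n) c → sAt c n t x ≡ T x (suc n) c t
sAt≡T x n c t z = begin
  evalUpTo (s c t) n x         ≡⟨ evalUpTo≡T (s c t) n x ⟩
  T x (suc n) (s c t) 0        ≡⟨ T-cong x (suc n) {s c t} {hasse c t} (s≗hasse c t) 0 ⟩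
  T x (suc n) (hasse c t) 0    ≡⟨ T-hasse x (suc n) c t z ⟩
  T x (suc n) c t              ∎
  where open ≡-Reasoning

-- The ℓ¹-norm of truncations and multiplication by F

norm : ℕ → Coeffs → ℕ
norm zero    u = 0
norm (suc N) u = ∣ u 0 ∣ + norm N (tail u)

norm-cong : ∀ N {u v} → u ≗ v → norm N u ≡ norm N v
norm-cong zero    e = refl
norm-cong (suc N) e = cong₂ (λ a b → ∣ a ∣ + b) (e 0) (norm-cong N (e ∘ suc))

norm-· : ∀ N x u → norm N (x · u) ≡ ∣ x ∣ * norm N u
norm-· zero    x u = sym (*-zeroʳ ∣ x ∣)
norm-· (suc N) x u = trans (cong₂ _+_ (ℤₚ.abs-* x (u 0)) (norm-· N x (tail u))) (sym (*-distribˡ-+ ∣ x ∣ ∣ u 0 ∣ _))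

∣i∣≤∣i+j∣+∣j∣ : ∀ i j → ∣ i ∣ ≤ ∣ i ℤ.+ j ∣ + ∣ j ∣
∣i∣≤∣i+j∣+∣j∣ i j = subst (λ z → ∣ z ∣ ≤ ∣ i ℤ.+ j ∣ + ∣ j ∣) (cancel i j) (ℤₚ.∣i-j∣≤∣i∣+∣j∣ (i ℤ.+ j) j)
  where
  cancel : ∀ i j → i ℤ.+ j ℤ.- j ≡ i
  cancel = solve-∀

norm-triangle : ∀ N u v → norm N u ≤ norm N (u ⊕ v) + norm N v
norm-triangle zero    u v = z≤n
norm-triangle (suc N) u v = begin
  ∣ u 0 ∣ + norm N (tail u)
    ≤⟨ +-mono-≤ (∣i∣≤∣i+j∣+∣j∣ (u 0) (v 0)) (norm-triangle N (tail u) (tail v)) ⟩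
  (∣ u 0 ℤ.+ v 0 ∣ + ∣ v 0 ∣) + (norm N (tail u ⊕ tail v) + norm N (tail v))
    ≡⟨ interchange ∣ u 0 ℤ.+ v 0 ∣ ∣ v 0 ∣ _ _ ⟩
  norm (suc N) (u ⊕ v) + norm (suc N) v ∎
  where
  open ≤-Reasoning
  interchange : ∀ a b c d → (a + b) + (c + d) ≡ (a + c) + (b + d)
  interchange = ℕ-solve-∀

norm-suc : ∀ N u → norm N u ≤ norm (suc N) u
norm-suc zero    u = z≤n
norm-suc (suc N) u = +-monoʳ-≤ ∣ u 0 ∣ (norm-suc N (tail u))

norm-zero : ∀ N {u} → u ≗ 0̂ → norm N u ≡ 0
norm-zero zero    e = refl
norm-zero (suc N) e = cong₂ (λ a b → ∣ a ∣ + b) (e 0) (norm-zero N (e ∘ suc))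

norm-bounded : ∀ N {L} u → Z L u → norm N u ≤ norm L u
norm-bounded N       {zero}  u z = ≤-reflexive (norm-zero N (λ k → z k z≤n))
norm-bounded zero    {suc L} u z = z≤n
norm-bounded (suc N) {suc L} u z = +-monoʳ-≤ ∣ u 0 ∣ (norm-bounded N (tail u) (Z-tail u z))

shift : Coeffs → Coeffs
shift u zero    = 0ℤ
shift u (suc k) = u k

norm-shift : ∀ N u → norm N (shift u) ≤ norm N u
norm-shift zero    u = z≤n
norm-shift (suc N) u = norm-suc N u

norm-lin : ∀ N m u → m * norm N u ≤ norm N (lin (+ m) u) + norm N u
norm-lin N m u = begin
  m * norm N u                                          ≡⟨ norm-· N (+ m) u ⟨
  norm N (+ m · u)                                      ≤⟨ norm-triangle N (+ m · u) (shift u) ⟩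
  norm N (+ m · u ⊕ shift u) + norm N (shift u)          ≤⟨ +-mono-≤ (≤-reflexive (norm-cong N split)) (norm-shift N u) ⟩
  norm N (lin (+ m) u) + norm N u                       ∎
  where
  open ≤-Reasoning
  split : + m · u ⊕ shift u ≗ lin (+ m) u
  split zero    = ℤₚ.+-identityʳ _
  split (suc k) = refl

-- Shifting power series is a contraction, so multiplication by y + m expands norms by a factor
-- of at least m - 1; the height bound makes the leading term of c dominate the others.
norm-expanding : ∀ m d c → (∀ i → i < d → ∣ c i ∣ + 2 * ∣ c d ∣ ≤ m * ∣ c d ∣) →
  ∀ N u → ∣ c d ∣ * norm N u ≤ norm N (mulC (T (+ m) (suc d) c) u)
norm-expanding m zero c _ N u = ≤-reflexive (trans (sym (norm-· N (c 0) u)) (norm-cong N (sym ∘ mul)))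
  where
  mul : mulC (T (+ m) 1 c) u ≗ c 0 · u
  mul k = trans (mulC-cong {h = u} (λ i → trans (cong (ℤ._+_ (cst (c 0) i)) (lin-zero (+ m) i)) (ℤₚ.+-identityʳ _)) (λ _ → refl) k) (mulC-cst (c 0) u k)
-- Here F = c(0) + (y + m)·V, where V has the same leading coefficient. Of the c₀ + 2A guaranteed by
-- the height bound, c₀ pays for the constant term, one A for the shift inside `lin`, and one A is
-- left. The summands c₀·n + A·n are added on both sides to avoid truncated subtraction.
norm-expanding m (suc d) c height N u = +-cancelˡ-≤ (c₀ * n + A * n) (A * n) (norm N E) (begin
  c₀ * n + A * n + A * n                     ≡⟨ collect c₀ A n ⟩
  (c₀ + 2 * A) * n                           ≤⟨ *-monoˡ-≤ n (height 0 (s≤s z≤n)) ⟩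
  m * A * n                                  ≡⟨ swap m A n ⟩
  A * (m * n)                                ≤⟨ *-monoʳ-≤ A (norm-lin N m u) ⟩
  A * (norm N (lin (+ m) u) + n)             ≡⟨ *-distribˡ-+ A _ n ⟩
  A * norm N (lin (+ m) u) + A * n           ≤⟨ +-monoˡ-≤ (A * n) (norm-expanding m d (tail c) (λ i i<d → height (suc i) (s≤s i<d)) N (lin (+ m) u)) ⟩
  norm N (mulC V (lin (+ m) u)) + A * n      ≡⟨ cong (_+ A * n) (norm-cong N slide) ⟩
  norm N Q + A * n                           ≤⟨ +-monoˡ-≤ (A * n) (norm-triangle N Q (c 0 · u)) ⟩
  norm N (Q ⊕ c 0 · u) + norm N (c 0 · u) + A * n  ≡⟨ cong₂ (λ a b → a + b + A * n) (norm-cong N expand) (norm-· N (c 0) u) ⟩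
  norm N E + c₀ * n + A * n                  ≡⟨ rotate (norm N E) (c₀ * n) (A * n) ⟩
  c₀ * n + A * n + norm N E                  ∎)
  where
  open ≤-Reasoning
  c₀ = ∣ c 0 ∣
  A = ∣ c (suc d) ∣
  n = norm N u
  V = T (+ m) (suc d) (tail c)
  E = mulC (T (+ m) (suc (suc d)) c) u
  Q = lin (+ m) (mulC V u)
  slide : mulC V (lin (+ m) u) ≗ Q
  slide k = trans (mulC-comm V (lin (+ m) u) k) (trans (mulC-linˡ (+ m) u V k) (lin-cong (+ m) (mulC-comm u V) k))
  expand : Q ⊕ c 0 · u ≗ E
  expand k = trans (ℤₚ.+-comm (Q k) (c 0 ℤ.* u k)) (sym
    (trans (mulC-⊕ˡ (cst (c 0)) (lin (+ m) V) u k) (cong₂ ℤ._+_ (mulC-cst (c 0) u k) (mulC-linˡ (+ m) V u k))))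
  collect : ∀ a b n → a * n + b * n + b * n ≡ (a + 2 * b) * n
  collect = ℕ-solve-∀
  swap : ∀ a b n → a * b * n ≡ b * (a * n)
  swap = ℕ-solve-∀
  rotate : ∀ a b c → a + b + c ≡ b + c + a
  rotate = ℕ-solve-∀

-- Division of power series by a series with constant term ±1

-- W r is the power series r / G, which has integer coefficients since G 0 = ±1; next performs one
-- step of the division.
module Division (G : Coeffs) (unit : G 0 ℤ.* G 0 ≡ 1ℤ) where

  next : Coeffs → Coeffs
  next r k = r (suc k) ℤ.- r 0 ℤ.* G 0 ℤ.* G (suc k)

  W : Coeffs → Coeffs
  W r zero    = r 0 ℤ.* G 0
  W r (suc k) = W (next r) k

  mulC-W : ∀ r → mulC G (W r) ≗ r
  mulC-W r zero    = trans (move (G 0) (r 0)) (trans (cong (r 0 ℤ.*_) unit) (ℤₚ.*-identityʳ (r 0)))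
    where
    move : ∀ a b → a ℤ.* (b ℤ.* a) ≡ b ℤ.* (a ℤ.* a)
    move = solve-∀
  mulC-W r (suc k) = begin
    mulC G (W r) (suc k)                                             ≡⟨ mulC-sucʳ G (W r) k ⟩
    G (suc k) ℤ.* (r 0 ℤ.* G 0) ℤ.+ mulC G (W (next r)) k            ≡⟨ cong (ℤ._+_ (G (suc k) ℤ.* (r 0 ℤ.* G 0))) (mulC-W (next r) k) ⟩
    G (suc k) ℤ.* (r 0 ℤ.* G 0) ℤ.+ next r k                         ≡⟨ cancel (G (suc k)) (r 0) (G 0) (r (suc k)) ⟩
    r (suc k)                                                       ∎
    where
    open ≡-Reasoning
    cancel : ∀ a b c d → a ℤ.* (b ℤ.* c) ℤ.+ (d ℤ.- b ℤ.* c ℤ.* a) ≡ d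
    cancel = solve-∀

  unit≢0 : G 0 ≢ 0ℤ
  unit≢0 G₀≡0 with () ← trans (sym unit) (cong (λ z → z ℤ.* z) G₀≡0)

  module _ {d} (G-deg : Z (suc d) G) (G-lead : G d ≢ 0ℤ) where

    Unbounded : ℕ → Coeffs → Set
    Unbounded N r = ∃ λ M → N ≤ norm M (W r)

    -- A nonzero remainder of degree below d stays nonzero, and at most d - 1 consecutive quotient
    -- digits vanish.
    norm-W-step : ∀ N → (∀ r → Z d r → ¬ (r ≗ 0̂) → Unbounded N r) →
      ∀ e r → e ≤ d → Z e r → ¬ (r ≗ 0̂) → Unbounded (suc N) r
    norm-W-step N rec zero    r e≤d z r≢0 = contradiction (λ k → z k z≤n) r≢0
    norm-W-step N rec (suc e) r e<d z r≢0 with r 0 ℤₚ.≟ 0ℤ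
    -- A vanishing digit adds nothing to the norm, but the new remainder is the tail of r, so its
    -- length bound e drops.
    ... | yes r₀≡0 = let M , le = norm-W-step N rec e (next r) (≤-trans (n≤1+n e) e<d)
                                    (λ k e≤k → trans (next≗tail k) (z (suc k) (s≤s e≤k))) next≢0
                     in suc M , ≤-trans le (m≤n+m _ _)
      where
      next≗tail : next r ≗ tail r
      next≗tail k = trans (cong (λ w → r (suc k) ℤ.- w ℤ.* G 0 ℤ.* G (suc k)) r₀≡0) (drop (r (suc k)) (G 0) (G (suc k)))
        where
        drop : ∀ a b c → a ℤ.- 0ℤ ℤ.* b ℤ.* c ≡ a
        drop = solve-∀
      next≢0 : ¬ (next r ≗ 0̂)
      next≢0 eq = r≢0 λ { zero → r₀≡0 ; (suc k) → trans (sym (next≗tail k)) (eq k) }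
    ... | no r₀≢0 = let M , le = rec (next r) next-deg (next≢0 d refl e<d)
                    in suc M , +-mono-≤ (n≢0⇒n>0 (W₀≢0 ∘ ℤₚ.∣i∣≡0⇒i≡0)) le
      where
      W₀≢0 : r 0 ℤ.* G 0 ≢ 0ℤ
      W₀≢0 eq = [ r₀≢0 , unit≢0 ]′ (ℤₚ.i*j≡0⇒i≡0∨j≡0 (r 0) eq)
      next-deg : Z d (next r)
      next-deg k d≤k = trans (cong₂ (λ a b → a ℤ.- r 0 ℤ.* G 0 ℤ.* b) (z (suc k) (≤-trans e<d (m≤n⇒m≤1+n d≤k))) (G-deg (suc k) (s≤s d≤k)))
        (drop (r 0 ℤ.* G 0))
        where
        drop : ∀ a → 0ℤ ℤ.- a ℤ.* 0ℤ ≡ 0ℤ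
        drop = solve-∀
      -- At index d - 1 the remainder r contributes r(d) = 0, which leaves minus the nonzero digit
      -- times the leading coefficient G(d). The variable i stands for d so that it can be matched
      -- as a successor.
      next≢0 : ∀ i → i ≡ d → suc e ≤ i → ¬ (next r ≗ 0̂)
      next≢0 (suc i) refl e<i eq = [ W₀≢0 , G-lead ]′ (ℤₚ.i*j≡0⇒i≡0∨j≡0 (r 0 ℤ.* G 0) (begin
        r 0 ℤ.* G 0 ℤ.* G (suc i)                                   ≡⟨ isolate (r (suc i)) (r 0 ℤ.* G 0 ℤ.* G (suc i)) ⟩
        r (suc i) ℤ.- (r (suc i) ℤ.- r 0 ℤ.* G 0 ℤ.* G (suc i))      ≡⟨ cong₂ ℤ._-_ (z (suc i) e<i) (eq i) ⟩
        0ℤ                                                         ∎))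
        where
        open ≡-Reasoning
        isolate : ∀ a b → b ≡ a ℤ.- (a ℤ.- b)
        isolate = solve-∀

    norm-W-unbounded : ∀ N r → Z d r → ¬ (r ≗ 0̂) → Unbounded N r
    norm-W-unbounded zero    r z r≢0 = 0 , z≤n
    norm-W-unbounded (suc N) r z r≢0 = norm-W-step N (norm-W-unbounded N) d r ≤-refl z r≢0

-- Factors whose value at m is ±1

T-length₂ : ∀ x L L′ {c} → Z L c → Z L′ c → T x L c ≗ T x L′ c
T-length₂ x L L′ {c} z z′ k = trans (sym (T-length x {L} {L + L′} {c} (m≤m+n L L′) z k)) (T-length x {L′} {L + L′} {c} (m≤n+m L′ L) z′ k)

T-factor : ∀ x {L L′ L″} g h {f} → Z L g → Z L′ h → Z L″ f → mulC g h ≗ f → mulC (T x L g) (T x L′ h) ≗ T x L″ f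
T-factor x {L} {L′} {L″} g h {f} zg zh zf gh≗f k = begin
  mulC (T x L g) (T x L′ h) k    ≡⟨ T-mulC x g h zg zh k ⟨
  T x (L + L′) (mulC g h) k      ≡⟨ T-cong x (L + L′) gh≗f k ⟩
  T x (L + L′) f k               ≡⟨ T-length x {L + L′} {L + L′ + L″} {f} (m≤m+n _ L″) zf′ k ⟨
  T x (L + L′ + L″) f k          ≡⟨ T-length x {L″} {L + L′ + L″} {f} (m≤n+m L″ (L + L′)) zf k ⟩
  T x L″ f k                     ∎
  where
  open ≡-Reasoning
  zf′ : Z (L + L′) f
  zf′ i le = trans (sym (gh≗f i)) (Z-mulC g h zg zh i le)

-- The number carried by a `Poly` is only an upper bound for its degree, whereas the division
-- argument needs a nonzero leading coefficient.
degree : ∀ L c → Z L c → c ≗ 0̂ ⊎ ∃ λ d → d < L × c d ≢ 0ℤ × Z (suc d) c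
degree zero    c z = inj₁ (λ k → z k z≤n)
degree (suc L) c z with c L ℤₚ.≟ 0ℤ
... | no  cL≢0 = inj₂ (L , ≤-refl , cL≢0 , z)
... | yes cL≡0 with degree L c z′
  where
  z′ : Z L c
  z′ k L≤k with m≤n⇒m<n∨m≡n L≤k
  ... | inj₁ L<k  = z k L<k
  ... | inj₂ refl = cL≡0
... | inj₁ c≗0                 = inj₁ c≗0
... | inj₂ (d , d<L , rest) = inj₂ (d , m≤n⇒m≤1+n d<L , rest)

∣i∣≡1⇒i*i≡1 : ∀ i → ∣ i ∣ ≡ 1 → i ℤ.* i ≡ 1ℤ
∣i∣≡1⇒i*i≡1 (+ 1)             refl = refl
∣i∣≡1⇒i*i≡1 (ℤ.-[1+ 0 ])      refl = refl

value : ℤ → Poly → ℤ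
value x (g , d , _) = T x (suc d) g 0

module Factors (m n : ℕ) (f : Coeffs) (f-deg : Z (suc n) f) (f-lead : f n ≢ 0ℤ)
  (height : ∀ i → i < n → ∣ f i ∣ + 2 * ∣ f n ∣ ≤ m * ∣ f n ∣) where

  norm-F : ∀ N u → norm N u ≤ norm N (mulC (T (+ m) (suc n) f) u)
  norm-F N u = ≤-trans (m≤n*m (norm N u) ∣ f n ∣ {{≢-nonZero (f-lead ∘ ℤₚ.∣i∣≡0⇒i≡0)}}) (norm-expanding m n f height N u)

  constant : ∀ {d} g h {L} → Z (suc d) g → g d ≢ 0ℤ → Z L h → mulC g h ≗ f → ∣ T (+ m) (suc d) g 0 ∣ ≡ 1 → d ≡ 0
  constant {zero}  g h zg gd≢0 zh gh≗f g₀ = refl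
  constant {suc d} g h {L} zg gd≢0 zh gh≗f g₀ = contradiction (≤-trans large bounded) (n≮n (norm L H))
    where
    G = T (+ m) (suc (suc d)) g
    H = T (+ m) L h
    unit = ∣i∣≡1⇒i*i≡1 (G 0) g₀
    open Division G unit
    -- The numerator 1 has degree below that of G because g is nonconstant, so the division never
    -- terminates.
    U = norm-W-unbounded {suc d} (Z-T (+ m) {suc (suc d)} {g}) (gd≢0 ∘ trans (sym (T-leading (+ m) (suc d) g))) (suc (norm L H)) oneC
          (λ { (suc k) _ → refl }) (λ e → contradiction (e 0) λ ())
    M = proj₁ U
    large = proj₂ U
    FW≗H : mulC (T (+ m) (suc n) f) (W oneC) ≗ H
    FW≗H k = begin
      mulC (T (+ m) (suc n) f) (W oneC) k   ≡⟨ mulC-cong {h = W oneC} (λ i → trans (sym (T-factor (+ m) g h {f} zg zh f-deg gh≗f i)) (mulC-comm G H i)) (λ _ → refl) k ⟩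
      mulC (mulC H G) (W oneC) k            ≡⟨ mulC-assoc H G (W oneC) k ⟩
      mulC H (mulC G (W oneC)) k            ≡⟨ mulC-cong {g = H} (λ _ → refl) (mulC-W oneC) k ⟩
      mulC H oneC k                         ≡⟨ mulC-oneʳ H k ⟩
      H k                                   ∎
      where open ≡-Reasoning
    bounded : norm M (W oneC) ≤ norm L H
    bounded = ≤-trans (norm-F M (W oneC)) (≤-trans (≤-reflexive (norm-cong M FW≗H)) (norm-bounded M H (Z-T (+ m) {L} {h})))

  value≡±1⇒unit : ∀ g h → mulP g h ≈P (f , n , f-deg) → ∣ value (+ m) g ∣ ≡ 1 → IsUnit g
  value≡±1⇒unit g@(c , d , z) h@(c′ , d′ , z′) gh≗f v≡1 with degree (suc d) c z
  ... | inj₁ c≗0 with () ← trans (sym v≡1) (cong ∣_∣ (T-zero (+ m) (suc d) c≗0 0))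
  -- Once g is known to be the constant ±1, it is its own inverse.
  ... | inj₂ (e , e<sd , ce≢0 , ze) = g , λ k → trans (mulC-cong {c} {cst (c 0)} {c} {cst (c 0)} c≗cst c≗cst k) (trans (mulC-cst (c 0) (cst (c 0)) k) (square k))
    where
    v′≡1 : ∣ T (+ m) (suc e) c 0 ∣ ≡ 1
    v′≡1 = trans (cong ∣_∣ (T-length₂ (+ m) (suc e) (suc d) {c} ze z 0)) v≡1
    e≡0 : e ≡ 0
    e≡0 = constant c c′ ze ce≢0 z′ gh≗f v′≡1
    c≗cst : c ≗ cst (c 0)
    c≗cst zero    = refl
    c≗cst (suc k) = ze (suc k) (s≤s (subst (_≤ k) (sym e≡0) z≤n))
    c₀≡1 : ∣ c 0 ∣ ≡ 1
    c₀≡1 = trans (cong ∣_∣ (sym (T-leading (+ m) 0 c))) (subst (λ i → ∣ T (+ m) (suc i) c 0 ∣ ≡ 1) e≡0 v′≡1)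
    square : c 0 · cst (c 0) ≗ oneC
    square zero    = ∣i∣≡1⇒i*i≡1 (c 0) c₀≡1
    square (suc k) = ℤₚ.*-zeroʳ (c 0)

-- Divisibility of convolutions and p-adic valuations

∣-+ : ∀ {d} x y → d ∣ ∣ x ∣ → d ∣ ∣ y ∣ → d ∣ ∣ x ℤ.+ y ∣
∣-+ {d} x y d∣x d∣y = ℤ∣.∣⇒∣ᵤ {+ d} (ℤ∣.∣m∣n⇒∣m+n (ℤ∣.∣ᵤ⇒∣ {+ d} {x} d∣x) (ℤ∣.∣ᵤ⇒∣ {+ d} {y} d∣y))

∣-+-cancelˡ : ∀ {d} x y → d ∣ ∣ x ℤ.+ y ∣ → d ∣ ∣ x ∣ → d ∣ ∣ y ∣
∣-+-cancelˡ {d} x y d∣x+y d∣x = ℤ∣.∣⇒∣ᵤ {+ d} (ℤ∣.∣m+n∣m⇒∣n {+ d} {x} {y} (ℤ∣.∣ᵤ⇒∣ {+ d} {x ℤ.+ y} d∣x+y) (ℤ∣.∣ᵤ⇒∣ {+ d} {x} d∣x))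

∣-*ˡ : ∀ {d} x y → d ∣ ∣ x ∣ → d ∣ ∣ x ℤ.* y ∣
∣-*ˡ x y d∣x = subst (_ ∣_) (sym (ℤₚ.abs-* x y)) (∣m⇒∣m*n ∣ y ∣ d∣x)

∣-*ʳ : ∀ {d} x y → d ∣ ∣ y ∣ → d ∣ ∣ x ℤ.* y ∣
∣-*ʳ x y d∣y = subst (_ ∣_) (sym (ℤₚ.abs-* x y)) (∣n⇒∣m*n ∣ x ∣ d∣y)

∣-conv : ∀ {d} g h k i → (∀ a → a ≤ i → d ∣ ∣ g a ℤ.* h (k ∸ a) ∣) → d ∣ ∣ conv g h k i ∣
∣-conv g h k zero    div = div 0 z≤n
∣-conv g h k (suc i) div = ∣-+ (conv g h k i) (g (suc i) ℤ.* h (k ∸ suc i))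
  (∣-conv g h k i (λ a a≤i → div a (m≤n⇒m≤1+n a≤i))) (div (suc i) ≤-refl)

∤-conv : ∀ {d} g h k i b → b ≤ i → (∀ a → a ≤ i → a ≢ b → d ∣ ∣ g a ℤ.* h (k ∸ a) ∣) →
  ¬ (d ∣ ∣ g b ℤ.* h (k ∸ b) ∣) → ¬ (d ∣ ∣ conv g h k i ∣)
∤-conv g h k zero    zero z≤n div ¬div = ¬div
∤-conv g h k (suc i) b b≤si div ¬div d∣sum with m≤n⇒m<n∨m≡n b≤si
... | inj₁ (s≤s b≤i) = ∤-conv g h k i b b≤i (λ a a≤i → div a (m≤n⇒m≤1+n a≤i)) ¬div
  (∣-+-cancelˡ t S (subst (λ z → _ ∣ ∣ z ∣) (ℤₚ.+-comm S t) d∣sum) (div (suc i) ≤-refl (λ si≡b → n≮n i (subst (_≤ i) (sym si≡b) b≤i))))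
  where
  S = conv g h k i
  t = g (suc i) ℤ.* h (k ∸ suc i)
... | inj₂ refl = ¬div (∣-+-cancelˡ (conv g h k i) (g (suc i) ℤ.* h (k ∸ suc i)) d∣sum
  (∣-conv g h k i (λ a a≤i → div a (m≤n⇒m≤1+n a≤i) (λ { refl → n≮n i a≤i }))))

-- The leftmost minimum is chosen because strictness on its left makes the product of two such terms
-- the only one of least weight in its coefficient of F.
firstMin : (w : ℕ → ℕ) (N : ℕ) → ∃ λ i → i ≤ N × (∀ i′ → i′ ≤ N → w i ≤ w i′) × (∀ i′ → i′ < i → w i < w i′)
firstMin w zero    = 0 , z≤n , (λ { _ z≤n → ≤-refl }) , λ _ ()
firstMin w (suc N) with firstMin w N
... | i , i≤N , min , first with w i ≤? w (suc N)
...   | yes wi≤ = i , m≤n⇒m≤1+n i≤N , min′ , first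
  where
  min′ : ∀ i′ → i′ ≤ suc N → w i ≤ w i′
  min′ i′ i′≤sN with m≤n⇒m<n∨m≡n i′≤sN
  ... | inj₁ (s≤s i′≤N) = min i′ i′≤N
  ... | inj₂ refl       = wi≤
...   | no wi≰  = suc N , ≤-refl , min′ , λ { i′ (s≤s i′≤N) → <-≤-trans (≰⇒> wi≰) (min i′ i′≤N) }
  where
  min′ : ∀ i′ → i′ ≤ suc N → w (suc N) ≤ w i′
  min′ i′ i′≤sN with m≤n⇒m<n∨m≡n i′≤sN
  ... | inj₁ (s≤s i′≤N) = ≤-trans (<⇒≤ (≰⇒> wi≰)) (min i′ i′≤N)
  ... | inj₂ refl       = ≤-refl

^-mono-∣ : ∀ p {a b} → a ≤ b → p ^ a ∣ p ^ b
^-mono-∣ p {a} {b} a≤b = subst (λ z → p ^ a ∣ p ^ z) (m+[n∸m]≡n a≤b)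
  (subst (p ^ a ∣_) (sym (^-distribˡ-+-* p a (b ∸ a))) (m∣m*n (p ^ (b ∸ a))))

Val-unique : ∀ {p x a b} → Val p x a → Val p x b → a ≡ b
Val-unique {p} {x} {a} {b} (pa , ¬pa) (pb , ¬pb) with <-cmp a b
... | tri< a<b _ _ = contradiction (∣-trans (^-mono-∣ p a<b) pb) ¬pa
... | tri≈ _ eq _  = eq
... | tri> _ _ b<a = contradiction (∣-trans (^-mono-∣ p b<a) pa) ¬pb

Val-* : ∀ {p} → Prime p → ∀ x y a b → Val p x a → Val p y b → Val p (x ℤ.* y) (a + b)
Val-* {p} pr x y a b (divides u eu , ¬pa) (divides v ev , ¬pb) = divides (u * v) eq , λ d →
    [ (λ p∣u → ¬pa (subst (p ^ suc a ∣_) (sym eu) (*-monoˡ-∣ (p ^ a) p∣u)))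
    , (λ p∣v → ¬pb (subst (p ^ suc b ∣_) (sym ev) (*-monoˡ-∣ (p ^ b) p∣v))) ]′
    (euclidsLemma u v pr (*-cancelʳ-∣ (p ^ (a + b)) {{m^n≢0 p (a + b) {{prime⇒nonZero pr}}}} (subst (p ^ suc (a + b) ∣_) eq d)))
  where
  eq : ∣ x ℤ.* y ∣ ≡ u * v * p ^ (a + b)
  eq = begin
    ∣ x ℤ.* y ∣                  ≡⟨ ℤₚ.abs-* x y ⟩
    ∣ x ∣ * ∣ y ∣                ≡⟨ cong₂ _*_ eu ev ⟩
    (u * p ^ a) * (v * p ^ b)    ≡⟨ interchange u (p ^ a) v (p ^ b) ⟩
    u * v * (p ^ a * p ^ b)      ≡⟨ cong (u * v *_) (^-distribˡ-+-* p a b) ⟨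
    u * v * p ^ (a + b)          ∎
    where
    open ≡-Reasoning
    interchange : ∀ a b c d → (a * b) * (c * d) ≡ a * c * (b * d)
    interchange = ℕ-solve-∀

-- The p-adic valuation truncated at K, so that 0 has valuation K.
val : ℕ → ℕ → ℤ → ℕ
val p zero    x = 0
val p (suc K) x with p ^ suc K ∣? ∣ x ∣
... | yes _ = suc K
... | no  _ = val p K x

val-∣ : ∀ p K x → p ^ val p K x ∣ ∣ x ∣
val-∣ p zero    x = 1∣ _
val-∣ p (suc K) x with p ^ suc K ∣? ∣ x ∣
... | yes d = d
... | no  _ = val-∣ p K x

val-Val : ∀ p K x → val p K x < K → Val p x (val p K x)
val-Val p K x lt = val-∣ p K x , exact K lt
  where
  exact : ∀ K → val p K x < K → ¬ (p ^ suc (val p K x) ∣ ∣ x ∣)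
  exact (suc K) lt with p ^ suc K ∣? ∣ x ∣
  ... | yes _ = contradiction lt (n≮n (suc K))
  ... | no ¬d with m≤n⇒m<n∨m≡n (s≤s⁻¹ lt)
  ...   | inj₁ lt′ = exact K lt′
  ...   | inj₂ eq  = λ d → ¬d (subst (λ z → p ^ suc z ∣ ∣ x ∣) eq d)

val≢0⇒∣ : ∀ p K x → val p K x ≢ 0 → p ∣ ∣ x ∣
val≢0⇒∣ p K x v≢0 with val p K x | val-∣ p K x
... | zero  | _ = contradiction refl v≢0
... | suc e | d = ∣-trans (m∣m*n (p ^ e)) d

-- The Newton polygon edge and its distribution among two factors

-- The Newton polygon of F at p has the edge from (0 , k) to (j , 0), which has no interior lattice
-- points, so it lies in the polygon of a single factor.
module Newton {p} (pr : Prime p) (k j : ℕ) (1≤k : 1 ≤ k) (1≤j : 1 ≤ j) (coprime : gcd k j ≡ 1)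
  (F : Coeffs) (F₀ : Val p (F 0) k) (Fⱼ : Val p (F j) 0)
  (edge : ∀ t → 1 ≤ t → t < j → ∀ e → Val p (F t) e → k * (j ∸ t) < e * j) where

  -- The valuations of G(0) and H(0) are at most k, so truncation one step higher leaves them exact
  -- while zero coefficients still get a finite value.
  K = suc k

  v : ℤ → ℕ
  v = val p K

  -- The linear form that is constant along the edge: both (0 , k) and (j , 0) have weight j·k.
  -- Multiplying by j avoids the fractional slope k/j.
  weight : Coeffs → ℕ → ℕ
  weight G i = j * v (G i) + k * i

  instance
    j≢0 : NonZero j
    j≢0 = >-nonZero 1≤j

  -- No point of F lies below the line of the edge: strictly between 0 and j this is condition (ii),
  -- and from j on the summand k·t alone reaches j·k.
  weight-F : ∀ t e → Val p (F t) e → j * k ≤ j * e + k * t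
  weight-F zero    e Fₑ = ≤-trans (*-monoʳ-≤ j (≤-reflexive (Val-unique {p} {F 0} F₀ Fₑ))) (m≤m+n (j * e) _)
  weight-F (suc t) e Fₑ with suc t <? j
  ... | no  t≮j = ≤-trans (≤-trans (≤-reflexive (*-comm j k)) (*-monoʳ-≤ k (≮⇒≥ t≮j))) (m≤n+m _ (j * e))
  ... | yes t<j = begin
    j * k                              ≡⟨ *-comm j k ⟩
    k * j                              ≡⟨ cong (k *_) (m∸n+n≡m (<⇒≤ t<j)) ⟨
    k * (j ∸ suc t + suc t)            ≡⟨ *-distribˡ-+ k (j ∸ suc t) (suc t) ⟩
    k * (j ∸ suc t) + k * suc t        ≤⟨ +-monoˡ-≤ (k * suc t) (<⇒≤ (edge (suc t) (s≤s z≤n) t<j e Fₑ)) ⟩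
    e * j + k * suc t                  ≡⟨ cong (_+ k * suc t) (*-comm e j) ⟩
    j * e + k * suc t                  ∎
    where open ≤-Reasoning

  FirstMin : Coeffs → ℕ → Set
  FirstMin G i = (∀ i′ → weight G i ≤ weight G i′) × (∀ i′ → i′ < i → weight G i < weight G i′)

  module Factor (G : Coeffs) (d : ∣ G 0 ∣ ∣ ∣ F 0 ∣) where

    α = v (G 0)

    α≤k : α ≤ k
    α≤k with m≤n⇒m<n∨m≡n (val≤ K)
      where
      val≤ : ∀ K → val p K (G 0) ≤ K
      val≤ zero = z≤n
      val≤ (suc K) with p ^ suc K ∣? ∣ G 0 ∣
      ... | yes _ = ≤-refl
      ... | no  _ = m≤n⇒m≤1+n (val≤ K)
    ... | inj₁ (s≤s le) = le
    ... | inj₂ eq = contradiction (∣-trans (subst (λ z → p ^ z ∣ ∣ G 0 ∣) eq (val-∣ p K (G 0))) d) (proj₂ F₀)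

    weight₀ : weight G 0 ≡ j * α
    weight₀ = trans (cong (_+_ (j * α)) (*-zeroʳ k)) (+-identityʳ _)

    minimum : ∃ (FirstMin G)
    -- Indices beyond j need no search: there k·i′ alone is at least j·k, hence at least the weight
    -- j·α at index 0.
    minimum with firstMin (weight G) j
    ... | i , _ , min , first = i , global , first
      where
      open ≤-Reasoning
      global : ∀ i′ → weight G i ≤ weight G i′
      global i′ with i′ ≤? j
      ... | yes i′≤j = min i′ i′≤j
      ... | no  i′≰j = begin
        weight G i      ≤⟨ min 0 z≤n ⟩
        weight G 0      ≡⟨ weight₀ ⟩
        j * α           ≤⟨ *-mono-≤ (<⇒≤ (≰⇒> i′≰j)) α≤k ⟩
        i′ * k          ≡⟨ *-comm i′ k ⟩
        k * i′          ≤⟨ m≤n+m (k * i′) _ ⟩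
        weight G i′     ∎

    -- A minimal weight is at most j·α, hence at most j·k, which keeps `v` below the truncation
    -- level.
    exact : ∀ {i} → FirstMin G i → Val p (G i) (v (G i))
    exact {i} (min , _) = val-Val p K (G i) (s≤s (*-cancelˡ-≤ j (begin
      j * v (G i)     ≤⟨ m≤m+n _ (k * i) ⟩
      weight G i      ≤⟨ min 0 ⟩
      weight G 0      ≡⟨ weight₀ ⟩
      j * α           ≤⟨ *-monoʳ-≤ j α≤k ⟩
      j * k           ∎)))
      where open ≤-Reasoning

  module _ (G H : Coeffs) (GH≗F : mulC G H ≗ F) where

    open Factor G (subst (∣ G 0 ∣ ∣_) (trans (sym (ℤₚ.abs-* (G 0) (H 0))) (cong ∣_∣ (GH≗F 0))) (m∣m*n ∣ H 0 ∣))
    open Factor H (subst (∣ H 0 ∣ ∣_) (trans (sym (ℤₚ.abs-* (G 0) (H 0))) (cong ∣_∣ (GH≗F 0))) (n∣m*n ∣ G 0 ∣))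
      renaming (α to β; α≤k to β≤k; weight₀ to weight₀′; minimum to minimum′; exact to exact′)

    α+β≡k : α + β ≡ k
    α+β≡k = Val-unique {p} {F 0} (subst (λ z → Val p z (α + β)) (GH≗F 0)
      (Val-* pr (G 0) (H 0) α β (val-Val p K (G 0) (s≤s α≤k)) (val-Val p K (H 0) (s≤s β≤k)))) F₀

    total : j * k ≡ j * α + j * β
    total = trans (cong (j *_) (sym α+β≡k)) (*-distribˡ-+ j α β)

    sum-weights : ∀ a b t → a + b ≡ t → weight G a + weight H b ≡ j * (v (G a) + v (H b)) + k * t
    sum-weights a b t refl = collect j (v (G a)) (v (H b)) k a b
      where
      collect : ∀ j x y k a b → j * x + k * a + (j * y + k * b) ≡ j * (x + y) + k * (a + b)
      collect = ℕ-solve-∀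

    -- The product of the two first terms of minimal weight is not cancelled in F.
    gauss : ∀ {i i′} → FirstMin G i → FirstMin H i′ → j * k ≤ weight G i + weight H i′
    gauss {i} {i′} μ@(min , first) μ′@(min′ , first′) =
      subst (j * k ≤_) (sym (sum-weights i i′ t refl)) (weight-F t e (divs , ndivs))
      where
      t = i + i′
      e = v (G i) + v (H i′)
      Gᵢ = exact μ
      Hᵢ = exact′ μ′
      t∸i : t ∸ i ≡ i′
      t∸i = m+n∸m≡n i i′
      lead : Val p (G i ℤ.* H (t ∸ i)) e
      lead = subst (λ z → Val p (G i ℤ.* H z) e) (sym t∸i) (Val-* pr (G i) (H i′) (v (G i)) (v (H i′)) Gᵢ Hᵢ)
      heavier : ∀ a → a ≤ t → a ≢ i → weight G i + weight H i′ < weight G a + weight H (t ∸ a)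
      heavier a a≤t a≢i with <-cmp a i
      ... | tri< a<i _ _ = +-mono-<-≤ (first a a<i) (min′ (t ∸ a))
      ... | tri≈ _ eq _  = contradiction eq a≢i
      ... | tri> _ _ i<a = +-mono-≤-< (min a) (first′ (t ∸ a) (subst (t ∸ a <_) t∸i (∸-monoʳ-< i<a a≤t)))
      rest : ∀ a → a ≤ t → a ≢ i → p ^ suc e ∣ ∣ G a ℤ.* H (t ∸ a) ∣
      rest a a≤t a≢i = ∣-trans (^-mono-∣ p (*-cancelˡ-< j e (v (G a) + v (H (t ∸ a))) (+-cancelʳ-< (k * t) _ _ lt)))
          (subst (p ^ (v (G a) + v (H (t ∸ a))) ∣_) (sym (ℤₚ.abs-* (G a) (H (t ∸ a))))
            (subst (_∣ ∣ G a ∣ * ∣ H (t ∸ a) ∣) (sym (^-distribˡ-+-* p (v (G a)) (v (H (t ∸ a)))))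
              (*-pres-∣ (val-∣ p K (G a)) (val-∣ p K (H (t ∸ a))))))
        where
        lt : j * e + k * t < j * (v (G a) + v (H (t ∸ a))) + k * t
        lt = subst₂ _<_ (sum-weights i i′ t refl) (sum-weights a (t ∸ a) t (m+[n∸m]≡n a≤t)) (heavier a a≤t a≢i)
      ndivs : ¬ (p ^ suc e ∣ ∣ F t ∣)
      ndivs d = ∤-conv G H t t i (m≤m+n i i′) rest (proj₂ lead) (subst (λ z → p ^ suc e ∣ ∣ z ∣) (sym (GH≗F t)) d)
      divs : p ^ e ∣ ∣ F t ∣
      divs = subst (λ z → p ^ e ∣ ∣ z ∣) (GH≗F t) (∣-conv G H t t each)
        where
        each : ∀ a → a ≤ t → p ^ e ∣ ∣ G a ℤ.* H (t ∸ a) ∣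
        each a a≤t with a ≟ i
        ... | yes refl = proj₁ lead
        ... | no  a≢i  = ∣-trans (^-mono-∣ p (n≤1+n e)) (rest a a≤t a≢i)

    -- By `gauss` the two minima add up to at least j·k = j·α + j·β. Neither exceeds the weight at
    -- index 0, which is j·α or j·β, so both are attained there.
    weight-G : ∀ a → j * α ≤ weight G a
    weight-G a = let i , μ = minimum ; i′ , μ′ = minimum′ in
      ≤-trans (+-cancelʳ-≤ (j * β) (j * α) (weight G i)
        (≤-trans (≤-reflexive (sym total)) (≤-trans (gauss μ μ′) (+-monoʳ-≤ (weight G i) (≤-trans (proj₁ μ′ 0) (≤-reflexive weight₀′))))))
        (proj₁ μ a)

    weight-H : ∀ b → j * β ≤ weight H b
    weight-H b = let i , μ = minimum ; i′ , μ′ = minimum′ in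
      ≤-trans (+-cancelˡ-≤ (j * α) (j * β) (weight H i′)
        (≤-trans (≤-reflexive (sym total)) (≤-trans (gauss μ μ′) (+-monoˡ-≤ (weight H i′) (≤-trans (proj₁ μ 0) (≤-reflexive weight₀))))))
        (proj₁ μ′ b)

    -- F(j) is prime to p, so some G(a) and H(j - a) would both be prime to p. Their weights k·a and
    -- k·(j - a) are at least j·α and j·β with the same sum, so k·a = j·α, and coprimality gives j ∣
    -- a. Then a is 0 or j, where G(0) or H(0) would be prime to p.
    not-both : p ∣ ∣ G 0 ∣ → ¬ (p ∣ ∣ H 0 ∣)
    not-both p∣G₀ p∣H₀ = proj₂ Fⱼ (subst (_∣ ∣ F j ∣) (sym (*-identityʳ p))
        (subst (λ z → p ∣ ∣ z ∣) (GH≗F j) (∣-conv G H j j each)))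
      where
      positive : ∀ x → p ∣ ∣ x ∣ → v x ≤ k → v x ≢ 0
      positive x p∣x v≤k v≡0 = subst (λ z → ¬ (p ^ suc z ∣ ∣ x ∣)) v≡0 (proj₂ (val-Val p K x (s≤s v≤k)))
        (subst (_∣ ∣ x ∣) (sym (*-identityʳ p)) p∣x)
      on-edge : ∀ x i → v x ≡ 0 → j * v x + k * i ≡ k * i
      on-edge x i v≡0 = cong (_+ k * i) (trans (cong (j *_) v≡0) (*-zeroʳ j))
      both-units : ∀ a → a ≤ j → v (G a) ≡ 0 → v (H (j ∸ a)) ≡ 0 → ⊥
      both-units a a≤j vG≡0 vH≡0 = contradiction (≤-antisym a≤j j≤a) λ a≡j →
          positive (H 0) p∣H₀ β≤k (n≤0⇒n≡0 (*-cancelˡ-≤ j (subst (j * β ≤_)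
            (trans (cong (k *_) (trans (cong (j ∸_) a≡j) (n∸n≡0 j))) (trans (*-zeroʳ k) (sym (*-zeroʳ j)))) jβ≤kb)))
        where
        open ≤-Reasoning
        jα≤ka : j * α ≤ k * a
        jα≤ka = subst (j * α ≤_) (on-edge (G a) a vG≡0) (weight-G a)
        jβ≤kb : j * β ≤ k * (j ∸ a)
        jβ≤kb = subst (j * β ≤_) (on-edge (H (j ∸ a)) (j ∸ a) vH≡0) (weight-H (j ∸ a))
        ka≤jα : k * a ≤ j * α
        ka≤jα = +-cancelʳ-≤ (j * β) (k * a) (j * α) (begin
          k * a + j * β              ≤⟨ +-monoʳ-≤ (k * a) jβ≤kb ⟩
          k * a + k * (j ∸ a)        ≡⟨ *-distribˡ-+ k a (j ∸ a) ⟨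
          k * (a + (j ∸ a))          ≡⟨ cong (k *_) (m+[n∸m]≡n a≤j) ⟩
          k * j                      ≡⟨ *-comm k j ⟩
          j * k                      ≡⟨ total ⟩
          j * α + j * β              ∎)
        j∣a : j ∣ a
        j∣a = coprime-divisor (Coprime.sym (gcd≡1⇒coprime {k} {j} coprime)) (divides α (trans (≤-antisym ka≤jα jα≤ka) (*-comm j α)))
        a≢0 : a ≢ 0
        a≢0 refl = positive (G 0) p∣G₀ α≤k vG≡0
        j≤a : j ≤ a
        j≤a = ∣⇒≤ {{≢-nonZero a≢0}} j∣a
      each : ∀ a → a ≤ j → p ∣ ∣ G a ℤ.* H (j ∸ a) ∣
      each a a≤j with v (G a) ≟ 0 | v (H (j ∸ a)) ≟ 0
      ... | no v≢0 | _      = ∣-*ˡ (G a) (H (j ∸ a)) (val≢0⇒∣ p K (G a) v≢0)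
      ... | yes _  | no v≢0 = ∣-*ʳ (G a) (H (j ∸ a)) (val≢0⇒∣ p K (H (j ∸ a)) v≢0)
      ... | yes e  | yes e′ = ⊥-elim (both-units a a≤j e e′)

-- Coefficient bounds from values at consecutive integers

-- Synthetic division: the coefficients of (c(z) - c(x)) / (z - x) are the values at x of the
-- successive tails of c.
quotient : ℤ → ℕ → Coeffs → Coeffs
quotient x zero    c         = 0̂
quotient x (suc L) c zero    = T x L (tail c) 0
quotient x (suc L) c (suc k) = quotient x L (tail c) k

Z-quotient : ∀ x L c → Z L (quotient x (suc L) c)
Z-quotient x zero    c zero    le       = refl
Z-quotient x zero    c (suc k) le       = refl
Z-quotient x (suc L) c (suc k) (s≤s le) = Z-quotient x L (tail c) k le

quotient-value : ∀ x y L c → (y ℤ.- x) ℤ.* T y L (quotient x (suc L) c) 0 ≡ T y (suc L) c 0 ℤ.- T x (suc L) c 0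
quotient-value x y zero c = simp (c 0) x y
  where
  simp : ∀ a x y → (y ℤ.- x) ℤ.* 0ℤ ≡ a ℤ.+ y ℤ.* 0ℤ ℤ.- (a ℤ.+ x ℤ.* 0ℤ)
  simp = solve-∀
quotient-value x y (suc L) c = begin
  (y ℤ.- x) ℤ.* (v ℤ.+ y ℤ.* q)                                            ≡⟨ expand x y v q ⟩
  (y ℤ.- x) ℤ.* v ℤ.+ y ℤ.* ((y ℤ.- x) ℤ.* q)                              ≡⟨ cong (λ z → (y ℤ.- x) ℤ.* v ℤ.+ y ℤ.* z) (quotient-value x y L (tail c)) ⟩
  (y ℤ.- x) ℤ.* v ℤ.+ y ℤ.* (T y (suc L) (tail c) 0 ℤ.- v)                 ≡⟨ collect x y v (T y (suc L) (tail c) 0) (c 0) ⟩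
  c 0 ℤ.+ y ℤ.* T y (suc L) (tail c) 0 ℤ.- (c 0 ℤ.+ x ℤ.* v)               ∎
  where
  open ≡-Reasoning
  v = T x (suc L) (tail c) 0
  q = T y L (quotient x (suc L) (tail c)) 0
  expand : ∀ x y v q → (y ℤ.- x) ℤ.* (v ℤ.+ y ℤ.* q) ≡ (y ℤ.- x) ℤ.* v ℤ.+ y ℤ.* ((y ℤ.- x) ℤ.* q)
  expand = solve-∀
  collect : ∀ x y v t a → (y ℤ.- x) ℤ.* v ℤ.+ y ℤ.* (t ℤ.- v) ≡ a ℤ.+ y ℤ.* t ℤ.- (a ℤ.+ x ℤ.* v)
  collect = solve-∀

quotient-coeff₀ : ∀ x L c → c 0 ≡ T x (suc L) c 0 ℤ.- x ℤ.* quotient x (suc L) c 0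
quotient-coeff₀ x L c = cancel (c 0) (x ℤ.* T x L (tail c) 0)
  where
  cancel : ∀ a b → a ≡ a ℤ.+ b ℤ.- b
  cancel = solve-∀

quotient-coeff : ∀ x L c → Z (suc L) c → ∀ k → c (suc k) ≡ quotient x (suc L) c k ℤ.- x ℤ.* quotient x (suc L) c (suc k)
quotient-coeff x zero    c z zero    = trans (z 1 (s≤s z≤n)) (sym (cong (λ w → 0ℤ ℤ.- w) (ℤₚ.*-zeroʳ x)))
quotient-coeff x zero    c z (suc k) = trans (z (suc (suc k)) (s≤s z≤n)) (sym (cong (λ w → 0ℤ ℤ.- w) (ℤₚ.*-zeroʳ x)))
quotient-coeff x (suc L) c z zero    = quotient-coeff₀ x L (tail c)
quotient-coeff x (suc L) c z (suc k) = quotient-coeff x L (tail c) (Z-tail c z) k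

-- A bound for the coefficients of a polynomial of length L with values at most b at the points
-- m , … , m + L - 1.
bound : ℕ → ℕ → ℕ → ℕ
bound m zero    b = 0
bound m (suc L) b = b + (1 + (m + L)) * bound m L (b + b)

coeff-bound : ∀ m L c b → Z L c → (∀ i → i < L → ∣ T (+ (m + i)) L c 0 ∣ ≤ b) → ∀ k → ∣ c k ∣ ≤ bound m L b
coeff-bound m zero    c b z le k = ≤-reflexive (cong ∣_∣ (z k z≤n))
coeff-bound m (suc L) c b z le = coeffs
  where
  x₀ = + (m + L)
  q = quotient x₀ (suc L) c
  β = bound m L (b + b)
  open ≤-Reasoning
  -- At the other sample points the divisor x - x₀ is a nonzero integer, so q is bounded there by a
  -- difference of two values of c. This is the origin of b + b.
  q-value : ∀ i → i < L → ∣ T (+ (m + i)) L q 0 ∣ ≤ b + b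
  q-value i i<L = begin
    ∣ T x L q 0 ∣                                  ≤⟨ m≤n*m _ ∣ x ℤ.- x₀ ∣ {{≢-nonZero distinct}} ⟩
    ∣ x ℤ.- x₀ ∣ * ∣ T x L q 0 ∣                    ≡⟨ ℤₚ.abs-* (x ℤ.- x₀) (T x L q 0) ⟨
    ∣ (x ℤ.- x₀) ℤ.* T x L q 0 ∣                    ≡⟨ cong ∣_∣ (quotient-value x₀ x L c) ⟩
    ∣ T x (suc L) c 0 ℤ.- T x₀ (suc L) c 0 ∣        ≤⟨ ℤₚ.∣i-j∣≤∣i∣+∣j∣ (T x (suc L) c 0) (T x₀ (suc L) c 0) ⟩
    ∣ T x (suc L) c 0 ∣ + ∣ T x₀ (suc L) c 0 ∣      ≤⟨ +-mono-≤ (le i (m≤n⇒m≤1+n i<L)) (le L ≤-refl) ⟩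
    b + b                                         ∎
    where
    x = + (m + i)
    distinct : ∣ x ℤ.- x₀ ∣ ≢ 0
    distinct eq = <⇒≢ (+-monoʳ-< m i<L) (ℤₚ.+-injective (ℤₚ.i-j≡0⇒i≡j x x₀ (ℤₚ.∣i∣≡0⇒i≡0 eq)))
  q-coeff : ∀ k → ∣ q k ∣ ≤ β
  q-coeff = coeff-bound m L q (b + b) (Z-quotient x₀ L c) q-value
  -- Multiplying back c = c(x₀) + (z - x₀)·q, each coefficient of c is c(x₀) or a coefficient of q,
  -- minus x₀ times the next coefficient of q; hence the factor 1 + (m + L).
  step : ∀ y z {u} → ∣ y ∣ ≤ u → ∣ z ∣ ≤ β → ∣ y ℤ.- x₀ ℤ.* z ∣ ≤ u + (m + L) * β
  step y z {u} y≤ z≤ = begin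
    ∣ y ℤ.- x₀ ℤ.* z ∣           ≤⟨ ℤₚ.∣i-j∣≤∣i∣+∣j∣ y (x₀ ℤ.* z) ⟩
    ∣ y ∣ + ∣ x₀ ℤ.* z ∣         ≡⟨ cong (_+_ ∣ y ∣) (ℤₚ.abs-* x₀ z) ⟩
    ∣ y ∣ + (m + L) * ∣ z ∣      ≤⟨ +-mono-≤ y≤ (*-monoʳ-≤ (m + L) z≤) ⟩
    u + (m + L) * β             ∎
  coeffs : ∀ k → ∣ c k ∣ ≤ b + (β + (m + L) * β)
  coeffs zero = begin
    ∣ c 0 ∣                                    ≡⟨ cong ∣_∣ (quotient-coeff₀ x₀ L c) ⟩
    ∣ T x₀ (suc L) c 0 ℤ.- x₀ ℤ.* q 0 ∣         ≤⟨ step (T x₀ (suc L) c 0) (q 0) (le L ≤-refl) (q-coeff 0) ⟩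
    b + (m + L) * β                           ≤⟨ +-monoʳ-≤ b (m≤n+m _ β) ⟩
    b + (β + (m + L) * β)                     ∎
  coeffs (suc k) = begin
    ∣ c (suc k) ∣                              ≡⟨ cong ∣_∣ (quotient-coeff x₀ L c z k) ⟩
    ∣ q k ℤ.- x₀ ℤ.* q (suc k) ∣                ≤⟨ step (q k) (q (suc k)) (q-coeff k) (q-coeff (suc k)) ⟩
    β + (m + L) * β                           ≤⟨ m≤n+m _ b ⟩
    b + (β + (m + L) * β)                     ∎

-- Exhaustive search over bounded polynomials

Bounded : ℕ → ℕ → Coeffs → Set
Bounded L b c = Z L c × (∀ k → ∣ c k ∣ ≤ b)

searchℤ : ∀ b {Q : ℤ → Set} → (∀ x → Dec (Q x)) → Dec (∃ λ x → ∣ x ∣ ≤ b × Q x)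
searchℤ b {Q} Q? = map′ to from (anyUpTo? (λ k → Q? (+ k) ⊎-dec Q? (ℤ.- + k)) (suc b))
  where
  to : (∃ λ k → k < suc b × (Q (+ k) ⊎ Q (ℤ.- + k))) → ∃ λ x → ∣ x ∣ ≤ b × Q x
  to (k , s≤s k≤b , inj₁ q) = + k , k≤b , q
  to (k , s≤s k≤b , inj₂ q) = ℤ.- + k , subst (_≤ b) (sym (ℤₚ.∣-i∣≡∣i∣ (+ k))) k≤b , q
  from : (∃ λ x → ∣ x ∣ ≤ b × Q x) → ∃ λ k → k < suc b × (Q (+ k) ⊎ Q (ℤ.- + k))
  from (+ k , le , q)          = k , s≤s le , inj₁ q
  from (ℤ.-[1+ k ] , le , q)   = suc k , s≤s le , inj₂ q

cons : ℤ → Coeffs → Coeffs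
cons x c zero    = x
cons x c (suc k) = c k

-- Sequences are functions and are rebuilt by `cons` only up to pointwise equality, so the predicate
-- is required to respect `≗`.
search : ∀ L b {P : Coeffs → Set} → (∀ c → Dec (P c)) → (∀ {c c′} → c ≗ c′ → P c → P c′) →
  Dec (∃ λ c → Bounded L b c × P c)
search zero b P? resp = map′ (λ p → 0̂ , ((λ _ _ → refl) , λ _ → z≤n) , p)
  (λ (c , (z , _) , p) → resp (λ k → z k z≤n) p) (P? 0̂)
search (suc L) b {P} P? resp = map′ to from
  (searchℤ b (λ x → search L b (λ c → P? (cons x c)) (λ e → resp (λ { zero → refl ; (suc k) → e k }))))
  where
  to : (∃ λ x → ∣ x ∣ ≤ b × ∃ λ c → Bounded L b c × P (cons x c)) → ∃ λ c → Bounded (suc L) b c × P c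
  to (x , x≤b , c , (z , c≤b) , p) = cons x c , ((λ { (suc k) (s≤s L≤k) → z k L≤k }) , λ { zero → x≤b ; (suc k) → c≤b k }) , p
  from : (∃ λ c → Bounded (suc L) b c × P c) → ∃ λ x → ∣ x ∣ ≤ b × ∃ λ c → Bounded L b c × P (cons x c)
  from (c , (z , c≤b) , p) = c 0 , c≤b 0 , tail c , (Z-tail c z , c≤b ∘ suc) , resp (λ { zero → refl ; (suc k) → refl }) p

mulC-leading : ∀ d d′ g h → Z (suc d) g → Z (suc d′) h → mulC g h (d + d′) ≡ g d ℤ.* h d′
mulC-leading zero    d′ g h zg zh = trans (mulC-cong {g} {cst (g 0)} {h} (λ { zero → refl ; (suc k) → zg (suc k) (s≤s z≤n) }) (λ _ → refl) d′) (mulC-cst (g 0) h d′)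
mulC-leading (suc d) d′ g h zg zh = begin
  mulC g h (suc (d + d′))                                    ≡⟨ mulC-suc g h (d + d′) ⟩
  g 0 ℤ.* h (suc (d + d′)) ℤ.+ mulC (tail g) h (d + d′)      ≡⟨ cong₂ (λ a b → g 0 ℤ.* a ℤ.+ b) (zh (suc (d + d′)) (s≤s (m≤n+m d′ d))) (mulC-leading d d′ (tail g) h (Z-tail g zg) zh) ⟩
  g 0 ℤ.* 0ℤ ℤ.+ g (suc d) ℤ.* h d′                          ≡⟨ drop (g 0) (g (suc d) ℤ.* h d′) ⟩
  g (suc d) ℤ.* h d′                                         ∎
  where
  open ≡-Reasoning
  drop : ∀ a b → a ℤ.* 0ℤ ℤ.+ b ≡ b
  drop = solve-∀

∣c∣≤norm : ∀ N u i → i < N → ∣ u i ∣ ≤ norm N u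
∣c∣≤norm (suc N) u zero    _         = m≤m+n ∣ u 0 ∣ _
∣c∣≤norm (suc N) u (suc i) (s≤s i<N) = ≤-trans (∣c∣≤norm N (tail u) i i<N) (m≤n+m _ ∣ u 0 ∣)

-- Deciding whether a divisor of f splits

module Decide (m n : ℕ) (f : Coeffs) (f-deg : Z (suc n) f) (f-lead : f n ≢ 0ℤ)
  (height : ∀ i → i < n → ∣ f i ∣ + 2 * ∣ f n ∣ ≤ m * ∣ f n ∣) where

  -- The height inequality persists when m grows to m + i. The norm estimate there, applied to the
  -- series 1 and truncated to one coefficient, reads 1 ≤ |f(m + i)|.
  f-value≢0 : ∀ i → ∣ T (+ (m + i)) (suc n) f 0 ∣ ≢ 0
  f-value≢0 i eq = contradiction (≤-trans (Factors.norm-F (m + i) n f f-deg f-lead height′ 1 oneC) (≤-reflexive zero-norm)) λ ()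
    where
    height′ : ∀ j → j < n → ∣ f j ∣ + 2 * ∣ f n ∣ ≤ (m + i) * ∣ f n ∣
    height′ j j<n = ≤-trans (height j j<n) (*-monoˡ-≤ ∣ f n ∣ (m≤m+n m i))
    zero-norm : norm 1 (mulC (T (+ (m + i)) (suc n) f) oneC) ≡ 0
    zero-norm = trans (+-identityʳ _) (trans (ℤₚ.abs-* (T (+ (m + i)) (suc n) f 0) 1ℤ) (trans (*-identityʳ _) eq))

  Divisor : Coeffs → Set
  Divisor g = ∃ λ L → Z L g × ∃ λ L′ → ∃ λ h → Z L′ h × mulC g h ≗ f

  -- The sum |f(m)| + ⋯ + |f(m + n)|, used as one bound for the values of every divisor at every
  -- sample point.
  b₀ = norm (suc n) (λ i → T (+ (m + i)) (suc n) f 0)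
  b = bound m (suc n) b₀

  divisor-Z : ∀ {g} → Divisor g → Z (suc n) g
  divisor-Z {g} (L , zg , L′ , h , zh , gh≗f) with degree L g zg | degree L′ h zh
  ... | inj₁ g≗0 | _        = contradiction (trans (sym (gh≗f n)) (mulC-zeroˡ h g≗0 n)) f-lead
  ... | inj₂ _   | inj₁ h≗0 = contradiction (trans (sym (gh≗f n)) (trans (mulC-comm g h n) (mulC-zeroˡ g h≗0 n))) f-lead
  ... | inj₂ (d , _ , gd≢0 , zg′) | inj₂ (d′ , _ , hd≢0 , zh′) = Z-mono {suc d} {suc n} {g} (s≤s (≤-trans (m≤m+n d d′) (≮⇒≥ n≮))) zg′
    where
    n≮ : ¬ (n < d + d′)
    n≮ lt = [ gd≢0 , hd≢0 ]′ (ℤₚ.i*j≡0⇒i≡0∨j≡0 (g d) (trans (sym (mulC-leading d d′ g h zg′ zh′)) (trans (gh≗f (d + d′)) (f-deg (d + d′) lt))))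

  divisor-bounded : ∀ {g} → Divisor g → Bounded (suc n) b g
  divisor-bounded {g} D@(L , zg , L′ , h , zh , gh≗f) = z , coeff-bound m (suc n) g b₀ z values
    where
    z = divisor-Z D
    values : ∀ i → i < suc n → ∣ T (+ (m + i)) (suc n) g 0 ∣ ≤ b₀
    values i i<sn = ≤-trans (∣⇒≤ {{≢-nonZero (f-value≢0 i)}} (subst (∣ T x (suc n) g 0 ∣ ∣_)
        (trans (sym (ℤₚ.abs-* (T x (suc n) g 0) (T x L′ h 0))) (cong ∣_∣ (T-factor x g h {f} z zh f-deg gh≗f 0)))
        (m∣m*n ∣ T x L′ h 0 ∣)))
      (∣c∣≤norm (suc n) (λ i → T (+ (m + i)) (suc n) f 0) i i<sn)
      where x = + (m + i)

  -- The range of k makes this decidable and loses nothing: a product of two sequences of length n +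
  -- 1 vanishes from 2(n + 1) on. Values other than ±1 at m stand for nonunits.
  Splitting : Coeffs → Coeffs → Coeffs → Set
  Splitting q g h = (∀ {k} → k < suc n + suc n → mulC g h k ≡ q k)
    × ∣ T (+ m) (suc n) g 0 ∣ ≢ 1 × ∣ T (+ m) (suc n) h 0 ∣ ≢ 1

  Splitting? : ∀ q g h → Dec (Splitting q g h)
  Splitting? q g h = allUpTo? (λ k → mulC g h k ℤₚ.≟ q k) _ ×-dec (¬? (_ ≟ 1) ×-dec ¬? (_ ≟ 1))

  Splitting-resp : ∀ q {g g′ h h′} → g ≗ g′ → h ≗ h′ → Splitting q g h → Splitting q g′ h′
  Splitting-resp q {g} {g′} {h} {h′} eg eh (prod , ng , nh) =
    (λ {k} lt → trans (sym (mulC-cong eg eh k)) (prod lt)) ,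
    (λ eq → ng (trans (cong ∣_∣ (T-cong (+ m) (suc n) eg 0)) eq)) ,
    (λ eq → nh (trans (cong ∣_∣ (T-cong (+ m) (suc n) eh 0)) eq))

  NontrivialFactors : Poly → Set
  NontrivialFactors q = ∃ λ g → ∃ λ h → mulP g h ≈P q × ∣ value (+ m) g ∣ ≢ 1 × ∣ value (+ m) h ∣ ≢ 1

  -- Factors of a divisor of f divide f as well, so the same length and coefficient bound serve for
  -- every q met in the recursion.
  NontrivialFactors? : ∀ q → Divisor (coeff q) → Dec (NontrivialFactors q)
  NontrivialFactors? q@(c , d , z) D@(_ , _ , L , l , zl , cl≗f) = map′ to from
    (search (suc n) b (λ g → search (suc n) b (Splitting? c g) (Splitting-resp c {g} {g} (λ _ → refl)))
      (λ {g} {g′} e (h , bh , sp) → h , bh , Splitting-resp c {g} {g′} {h} {h} e (λ _ → refl) sp))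
    where
    to : (∃ λ g → Bounded (suc n) b g × ∃ λ h → Bounded (suc n) b h × Splitting c g h) → NontrivialFactors q
    to (g , (zg , _) , h , (zh , _) , prod , ng , nh) = (g , n , zg) , (h , n , zh) , eq , ng , nh
      where
      eq : mulC g h ≗ c
      eq k with k <? suc n + suc n
      ... | yes lt = prod lt
      ... | no ≮   = trans (Z-mulC g h zg zh k (≮⇒≥ ≮)) (sym (divisor-Z D k (≤-trans (m≤m+n (suc n) (suc n)) (≮⇒≥ ≮))))
    from : NontrivialFactors q → ∃ λ g → Bounded (suc n) b g × ∃ λ h → Bounded (suc n) b h × Splitting c g h
    from ((g , dg , zg) , (h , dh , zh) , eq , ng , nh) = g , divisor-bounded Dg , h , divisor-bounded Dh , (λ {k} _ → eq k) ,
        (λ e → ng (trans (cong ∣_∣ (T-length₂ (+ m) (suc dg) (suc n) {g} zg (divisor-Z Dg) 0)) e)) ,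
        (λ e → nh (trans (cong ∣_∣ (T-length₂ (+ m) (suc dh) (suc n) {h} zh (divisor-Z Dh) 0)) e))
      where
      Dg : Divisor g
      Dg = _ , zg , _ , mulC h l , Z-mulC h l zh zl , λ k → trans (sym (mulC-assoc g h l k)) (trans (mulC-cong {h = l} eq (λ _ → refl) k) (cl≗f k))
      Dh : Divisor h
      Dh = _ , zh , _ , mulC g l , Z-mulC g l zg zl , λ k → trans (sym (mulC-assoc h g l k))
        (trans (mulC-cong {h = l} (λ i → trans (mulC-comm h g i) (eq i)) (λ _ → refl) k) (cl≗f k))

-- Counting indices with a decidable property

indicator : ∀ {P : Set} → Dec P → ℕ
indicator (yes _) = 1
indicator (no  _) = 0

count : ∀ {r} {P : Fin r → Set} → (∀ i → Dec (P i)) → ℕ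
count {zero}  P? = 0
count {suc r} P? = indicator (P? Fin.zero) + count (P? ∘ Fin.suc)

count-positive : ∀ {r} {P : Fin r → Set} (P? : ∀ i → Dec (P i)) {i} → P i → 1 ≤ count P?
count-positive P? {Fin.zero} Pi with P? Fin.zero
... | yes _  = s≤s z≤n
... | no  ¬P = contradiction Pi ¬P
count-positive P? {Fin.suc i} Pi = ≤-trans (count-positive (P? ∘ Fin.suc) Pi) (m≤n+m _ (indicator (P? Fin.zero)))

count-disjoint : ∀ {r} {P Q R : Fin r → Set} (P? : ∀ i → Dec (P i)) (Q? : ∀ i → Dec (Q i)) (R? : ∀ i → Dec (R i)) →
  (∀ i → P i → R i) → (∀ i → Q i → R i) → (∀ i → P i → ¬ Q i) → count P? + count Q? ≤ count R?
count-disjoint {zero}  P? Q? R? P⇒R Q⇒R disj = z≤n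
count-disjoint {suc r} P? Q? R? P⇒R Q⇒R disj = begin
  (p + ps) + (q + qs)     ≡⟨ interchange p ps q qs ⟩
  (p + q) + (ps + qs)     ≤⟨ +-mono-≤ head (count-disjoint (P? ∘ Fin.suc) (Q? ∘ Fin.suc) (R? ∘ Fin.suc) (P⇒R ∘ Fin.suc) (Q⇒R ∘ Fin.suc) (disj ∘ Fin.suc)) ⟩
  count R?                ∎
  where
  open ≤-Reasoning
  p = indicator (P? Fin.zero)
  q = indicator (Q? Fin.zero)
  ps = count (P? ∘ Fin.suc)
  qs = count (Q? ∘ Fin.suc)
  interchange : ∀ a b c d → (a + b) + (c + d) ≡ (a + c) + (b + d)
  interchange = ℕ-solve-∀
  head : p + q ≤ indicator (R? Fin.zero)
  head with P? Fin.zero | Q? Fin.zero | R? Fin.zero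
  ... | yes Pi | yes Qi | _      = contradiction Qi (disj Fin.zero Pi)
  ... | yes Pi | no _   | yes _  = ≤-refl
  ... | yes Pi | no _   | no ¬R  = contradiction (P⇒R Fin.zero Pi) ¬R
  ... | no _   | yes _  | yes _  = ≤-refl
  ... | no _   | yes Qi | no ¬R  = contradiction (Q⇒R Fin.zero Qi) ¬R
  ... | no _   | no _   | _      = z≤n

count≤ : ∀ {r} {P : Fin r → Set} (P? : ∀ i → Dec (P i)) → count P? ≤ r
count≤ {zero}  P? = z≤n
count≤ {suc r} P? with P? Fin.zero
... | yes _ = s≤s (count≤ (P? ∘ Fin.suc))
... | no  _ = m≤n⇒m≤1+n (count≤ (P? ∘ Fin.suc))

-- Prime divisors and valuations of the product of prime powers

prime∤1 : ∀ {p} → Prime p → ¬ (p ∣ 1)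
prime∤1 pr p∣1 = nonTrivial⇒≢1 {{prime⇒nonTrivial pr}} (∣1⇒≡1 p∣1)

prime∣^ : ∀ {p} → Prime p → ∀ q k → p ∣ q ^ k → p ∣ q
prime∣^ pr q zero    d = contradiction d (prime∤1 pr)
prime∣^ pr q (suc k) d = [ (λ p∣q → p∣q) , prime∣^ pr q k ]′ (euclidsLemma q (q ^ k) pr d)

prime∣prime : ∀ {p q} → Prime p → Prime q → p ∣ q → p ≡ q
prime∣prime {p} pr qr p∣q with prime⇒irreducible qr p∣q
... | inj₁ refl = contradiction ∣-refl (prime∤1 pr)
... | inj₂ eq   = eq

prime∣prodFin : ∀ {p} → Prime p → ∀ r (q k : Fin r → ℕ) → (∀ i → Prime (q i)) → p ∣ prodFin r (λ i → q i ^ k i) → ∃ λ i → p ≡ q i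
prime∣prodFin pr zero    q k qr d = contradiction d (prime∤1 pr)
prime∣prodFin pr (suc r) q k qr d with euclidsLemma (q Fin.zero ^ k Fin.zero) _ pr d
... | inj₁ d₀ = Fin.zero , prime∣prime pr (qr Fin.zero) (prime∣^ pr (q Fin.zero) (k Fin.zero) d₀)
... | inj₂ d′ = let i , eq = prime∣prodFin pr r (q ∘ Fin.suc) (k ∘ Fin.suc) (qr ∘ Fin.suc) d′ in Fin.suc i , eq

Val-0 : ∀ {p x} → ¬ (p ∣ ∣ x ∣) → Val p x 0
Val-0 {p} {x} p∤x = 1∣ _ , λ d → p∤x (subst (_∣ ∣ x ∣) (*-identityʳ p) d)

Val-^ : ∀ {p} → Prime p → ∀ k → Val p (+ (p ^ k)) k
Val-^ {p} pr k = ∣-refl , λ d → n≮n (p ^ k) (<-≤-trans (m<n*m p^k p {{pk≢0}} (nonTrivial⇒n>1 p {{prime⇒nonTrivial pr}})) (∣⇒≤ {{pk≢0}} d))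
  where
  p^k = p ^ k
  pk≢0 : NonZero (p ^ k)
  pk≢0 = m^n≢0 p k {{prime⇒nonZero pr}}
  m<n*m : ∀ m n {{_ : NonZero m}} → 1 < n → m < n * m
  m<n*m m n 1<n = subst (_< n * m) (*-identityˡ m) (*-monoˡ-< m 1<n)

Val-prodFin : ∀ r (p k : Fin r → ℕ) → (∀ i → Prime (p i)) → (∀ i i′ → p i ≡ p i′ → i ≡ i′) →
  ∀ i → Val (p i) (+ prodFin r (λ i → p i ^ k i)) (k i)
Val-prodFin (suc r) p k pr inj i = subst (λ z → Val (p i) z (k i)) (sym (ℤₚ.pos-* p₀ rest)) (split i)
  where
  p₀ = p Fin.zero ^ k Fin.zero
  rest = prodFin r (λ i → p (Fin.suc i) ^ k (Fin.suc i))
  split : ∀ i → Val (p i) (+ p₀ ℤ.* + rest) (k i)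
  split Fin.zero = subst (Val (p Fin.zero) (+ p₀ ℤ.* + rest)) (+-identityʳ (k Fin.zero))
    (Val-* (pr Fin.zero) (+ p₀) (+ rest) (k Fin.zero) 0 (Val-^ (pr Fin.zero) (k Fin.zero)) (Val-0 {p Fin.zero} {+ rest} ∤rest))
    where
    ∤rest : ¬ (p Fin.zero ∣ rest)
    ∤rest d with prime∣prodFin (pr Fin.zero) r (p ∘ Fin.suc) (k ∘ Fin.suc) (pr ∘ Fin.suc) d
    ... | i , eq with () ← inj Fin.zero (Fin.suc i) eq
  split (Fin.suc i) = Val-* (pr (Fin.suc i)) (+ p₀) (+ rest) 0 (k (Fin.suc i)) (Val-0 {p (Fin.suc i)} {+ p₀} ∤p₀)
    (Val-prodFin r (p ∘ Fin.suc) (k ∘ Fin.suc) (pr ∘ Fin.suc) (λ i i′ eq → suc-injective (inj (Fin.suc i) (Fin.suc i′) eq)) i)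
    where
    ∤p₀ : ¬ (p (Fin.suc i) ∣ p₀)
    ∤p₀ d with () ← inj (Fin.suc i) Fin.zero (prime∣prime (pr (Fin.suc i)) (pr Fin.zero) (prime∣^ (pr (Fin.suc i)) (p Fin.zero) (k Fin.zero) d))

cancel-prime : ∀ {p v y} → Prime p → ¬ (p ∣ v) → v ∣ p * y → v ∣ y
cancel-prime {p} {v} {y} pr p∤v (divides q eq) with euclidsLemma q v pr (divides y (trans (sym eq) (*-comm p y)))
... | inj₂ p∣v             = contradiction p∣v p∤v
... | inj₁ (divides c refl) = divides c (*-cancelˡ-≡ y (c * v) p {{prime⇒nonZero pr}} (trans eq (move c p v)))
  where
  move : ∀ c p v → c * p * v ≡ p * (c * v)
  move = ℕ-solve-∀

cancel-prime-power : ∀ {p v y} → Prime p → ¬ (p ∣ v) → ∀ k → v ∣ p ^ k * y → v ∣ y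
cancel-prime-power {p} {v} {y} pr p∤v zero    d = subst (v ∣_) (*-identityˡ y) d
cancel-prime-power {p} {v} {y} pr p∤v (suc k) d = cancel-prime-power pr p∤v k (cancel-prime pr p∤v (subst (v ∣_) (*-assoc p (p ^ k) y) d))

-- A power of a prime not dividing v can be cancelled from the product. If this happened for all of
-- them, v would divide 1.
prime-divisor : ∀ r (p k : Fin r → ℕ) → (∀ i → Prime (p i)) → ∀ v → v ∣ prodFin r (λ i → p i ^ k i) → v ≢ 1 → ∃ λ i → p i ∣ v
prime-divisor zero    p k pr v d v≢1 = contradiction (∣1⇒≡1 d) v≢1
prime-divisor (suc r) p k pr v d v≢1 with p Fin.zero ∣? v
... | yes p∣v = Fin.zero , p∣v
... | no  p∤v = let i , p∣v = prime-divisor r (p ∘ Fin.suc) (k ∘ Fin.suc) (pr ∘ Fin.suc) v (cancel-prime-power (pr Fin.zero) p∤v (k Fin.zero) d) v≢1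
                in Fin.suc i , p∣v

-- Assembling the factorisation

productP-++ : ∀ gs hs → productP (gs ++ hs) ≈P mulP (productP gs) (productP hs)
productP-++ []       hs k = sym (mulC-oneˡ (coeff (productP hs)) k)
productP-++ (g ∷ gs) hs k = trans (mulC-cong {coeff g} (λ _ → refl) (productP-++ gs hs) k)
  (sym (mulC-assoc (coeff g) (coeff (productP gs)) (coeff (productP hs)) k))

value-mulP : ∀ x g h q → mulP g h ≈P q → value x g ℤ.* value x h ≡ value x q
value-mulP x (g , _ , zg) (h , _ , zh) (q , _ , zq) e = T-factor x g h {q} zg zh zq e 0

theorem1 : (n : ℕ) (a : Coeffs) (ha : ∀ k → n < k → a k ≡ 0ℤ)
    → 1 ≤ n
    → Primitive a n
    → a 0 ≢ 0ℤ
    → a n ≢ 0ℤ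
    → (m : ℕ) → 1 ≤ m
    → (∀ i → i < n → ∣ a i ∣ + 2 * ∣ a n ∣ ≤ m * ∣ a n ∣)
    → (r : ℕ) (p k : Fin r → ℕ)
    → (∀ i → Prime (p i))
    → (∀ i → 1 ≤ k i)
    → (∀ i i′ → p i ≡ p i′ → i ≡ i′)
    → ∣ evalUpTo a n (+ m) ∣ ≡ prodFin r (λ i → p i ^ k i)
    → (∀ i → ∃ λ j → 1 ≤ j × j ≤ n
    × Val (p i) (sAt a n j (+ m)) 0
    × gcd (k i) j ≡ 1
    × (1 < j → ∀ t → 1 ≤ t → t < j → ∀ e → Val (p i) (sAt a n t (+ m)) e
    → k i * (j ∸ t) < e * j))
    → ∃ λ (gs : List Poly) → length gs ≤ r × All Irreducible gs
    × productP gs ≈P (a , n , ha)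
theorem1 n a ha 1≤n _ _ aₙ≢0 m _ height r p k pr 1≤k inj f[m] newton =
    let gs , len , irr , prod = factorise r f (oneP , mulC-oneʳ a) f≢1 (count≤ _)
    in gs , ≤-trans len (count≤ _) , irr , prod
  where
  f : Poly
  f = a , n , ha

  x = + m
  F = T x (suc n) a

  open Factors m n a ha aₙ≢0 height
  open Decide m n a ha aₙ≢0 height

  ∣F₀∣ : ∣ F 0 ∣ ≡ prodFin r (λ i → p i ^ k i)
  ∣F₀∣ = trans (cong ∣_∣ (sym (evalUpTo≡T a n x))) f[m]

  F₀ : ∀ i → Val (p i) (F 0) (k i)
  F₀ i = subst (λ z → p i ^ k i ∣ z × ¬ (p i ^ suc (k i) ∣ z)) (sym ∣F₀∣) (Val-prodFin r p k pr inj i)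

  disjoint : ∀ g h → mulP g h ≈P f → ∀ i → p i ∣ ∣ value x g ∣ → ¬ (p i ∣ ∣ value x h ∣)
  disjoint (g , dg , zg) (h , dh , zh) gh≈f i with newton i
  ... | j , 1≤j , _ , Fⱼ , coprime , edge =
    Newton.not-both (pr i) (k i) j (1≤k i) 1≤j coprime F (F₀ i) (subst (λ z → Val (p i) z 0) (sAt≡T x n a j ha) Fⱼ)
      (λ t 1≤t t<j e Fₜ → edge (≤-<-trans 1≤t t<j) t 1≤t t<j e (subst (λ z → Val (p i) z e) (sym (sAt≡T x n a t ha)) Fₜ))
      (T x (suc dg) g) (T x (suc dh) h) (T-factor x g h {a} zg zh ha gh≈f)

  -- The hypotheses speak of f alone. Keeping the complementary factor lets a splitting q = g·h be
  -- regrouped as the two-factor product g·(h·l) = f, to which they apply.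
  Cofactor : Poly → Set
  Cofactor q = ∃ λ l → mulP q l ≈P f

  divisor : ∀ q → Cofactor q → Divisor (coeff q)
  divisor (q , d , z) ((l , d′ , z′) , ql≈f) = suc d , z , suc d′ , l , z′ , ql≈f

  -- For the factorisation f = f·1 a value ±1 would force n = 0. In particular r = 0 is impossible.
  f≢1 : ∣ value x f ∣ ≢ 1
  f≢1 eq = contradiction (constant a oneC {1} ha aₙ≢0 (λ { (suc _) _ → refl }) (mulC-oneʳ a) eq) (m<n⇒n≢0 1≤n)

  divides? : ∀ q i → Dec (p i ∣ ∣ value x q ∣)
  divides? q i = p i ∣? ∣ value x q ∣

  ν : Poly → ℕ
  ν q = count (divides? q)

  ν-positive : ∀ q → Cofactor q → ∣ value x q ∣ ≢ 1 → 1 ≤ ν q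
  ν-positive q (l , ql≈f) q≢1 = count-positive (divides? q) (proj₂ (prime-divisor r p k pr ∣ value x q ∣
    (subst (∣ value x q ∣ ∣_) (trans (cong ∣_∣ (value-mulP x q l f ql≈f)) ∣F₀∣) (∣-*ˡ (value x q) (value x l) ∣-refl)) q≢1))

  cofactors : ∀ g h q → mulP g h ≈P q → Cofactor q → (∃ λ l → mulP g (mulP h l) ≈P f) × (∃ λ l → mulP h (mulP g l) ≈P f)
  cofactors g h q gh≈q (l , ql≈f) =
    (l , λ i → trans (sym (mulC-assoc (coeff g) (coeff h) (coeff l) i)) (trans (mulC-cong {h = coeff l} gh≈q (λ _ → refl) i) (ql≈f i))) ,
    (l , λ i → trans (sym (mulC-assoc (coeff h) (coeff g) (coeff l) i))
      (trans (mulC-cong {h = coeff l} (λ i → trans (mulC-comm (coeff h) (coeff g) i) (gh≈q i)) (λ _ → refl) i) (ql≈f i)))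

  ν-mulP : ∀ g h q → mulP g h ≈P q → Cofactor q → ν g + ν h ≤ ν q
  ν-mulP g h q gh≈q Q = count-disjoint (divides? g) (divides? h) (divides? q)
    (λ i d → subst (λ z → p i ∣ ∣ z ∣) (value-mulP x g h q gh≈q) (∣-*ˡ (value x g) (value x h) d))
    (λ i d → subst (λ z → p i ∣ ∣ z ∣) (value-mulP x g h q gh≈q) (∣-*ʳ (value x g) (value x h) d))
    (λ i d d′ → let l , ghl≈f = proj₁ (cofactors g h q gh≈q Q) in
      disjoint g (mulP h l) ghl≈f i d
        (subst (λ z → p i ∣ ∣ z ∣) (value-mulP x h l (mulP h l) (λ _ → refl)) (∣-*ˡ (value x h) (value x l) d′)))

  irreducible : ∀ q → Cofactor q → ∣ value x q ∣ ≢ 1 → ¬ NontrivialFactors q → Irreducible q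
  irreducible q Q@(l , ql≈f) q≢1 ¬split = q≉0 , ¬unit , prime-like
    where
    q≉0 : ¬ (q ≈P zeroP)
    q≉0 q≈0 = aₙ≢0 (trans (sym (ql≈f n)) (mulC-zeroˡ (coeff l) q≈0 n))
    ¬unit : ¬ IsUnit q
    ¬unit (u , qu≈1) = q≢1 (∣1⇒≡1 (subst (∣ value x q ∣ ∣_)
      (cong ∣_∣ (trans (value-mulP x q u oneP qu≈1) (T-leading x 0 oneC))) (∣-*ˡ (value x q) (value x u) ∣-refl)))
    prime-like : ∀ g h → q ≈P mulP g h → IsUnit g ⊎ IsUnit h
    prime-like g h q≈gh with ∣ value x g ∣ ≟ 1 | ∣ value x h ∣ ≟ 1 | cofactors g h q (λ i → sym (q≈gh i)) Q
    ... | yes g≡1 | _       | (l′ , e) , _ = inj₁ (value≡±1⇒unit g (mulP h l′) e g≡1)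
    ... | no _    | yes h≡1 | _ , (l′ , e) = inj₂ (value≡±1⇒unit h (mulP g l′) e h≡1)
    ... | no g≢1  | no h≢1  | _ = contradiction (g , h , (λ i → sym (q≈gh i)) , g≢1 , h≢1) ¬split

  -- N makes the recursion structural. The count `ν` is positive on g and h and superadditive, so
  -- each has a smaller count than q, and the lengths of the two lists add up to at most `ν q`.
  factorise : ∀ N q → Cofactor q → ∣ value x q ∣ ≢ 1 → ν q ≤ N →
    ∃ λ gs → length gs ≤ ν q × All Irreducible gs × productP gs ≈P q
  factorise zero    q Q q≢1 ν≤N = contradiction (≤-trans (ν-positive q Q q≢1) ν≤N) λ ()
  factorise (suc N) q Q q≢1 ν≤N with NontrivialFactors? q (divisor q Q)
  ... | no ¬split = (q ∷ []) , ν-positive q Q q≢1 , irreducible q Q q≢1 ¬split ∷ [] , mulC-oneʳ (coeff q)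
  ... | yes (g , h , gh≈q , g≢1 , h≢1) =
    let (l , ghl≈f) , (l′ , hgl≈f) = cofactors g h q gh≈q Q
        G = mulP h l , ghl≈f
        H = mulP g l′ , hgl≈f
        sum = ν-mulP g h q gh≈q Q
        gs , gs-len , gs-irr , gs-prod = factorise N g G g≢1
          (s≤s⁻¹ (≤-trans (≤-trans (≤-reflexive (+-comm 1 (ν g))) (+-monoʳ-≤ (ν g) (ν-positive h H h≢1))) (≤-trans sum ν≤N)))
        hs , hs-len , hs-irr , hs-prod = factorise N h H h≢1
          (s≤s⁻¹ (≤-trans (+-monoˡ-≤ (ν h) (ν-positive g G g≢1)) (≤-trans sum ν≤N)))
    in gs ++ hs
     , ≤-trans (≤-reflexive (length-++ gs)) (≤-trans (+-mono-≤ gs-len hs-len) sum)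
     , ++⁺ gs-irr hs-irr
     , λ i → trans (productP-++ gs hs i) (trans (mulC-cong gs-prod hs-prod i) (gh≈q i))
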